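{- There exists a constant $\delta>0$ such that for all sufficiently large integers $k$, every hypergraph $H=(V,E)$ with $s_{\min}(H)\geq k$ and $q(H)\leq \delta\cdot\log k$ is two colorable.
   Context: A hypergraph $H=(V,E)$ consists of a finite vertex set $V$ and a set $E$ of edges, each edge being a subset of $V$ of size at least $2$ (edges may have different sizes). A two coloring assigns to each vertex one of two colors (blue or red); it is proper if every edge contains a blue vertex and a red vertex, and $H$ is two colorable if it admits a proper two coloring. $s_{\min}(H)=\min_{e\in E}|e|$ is the minimum size of an edge. $q(H)=\sum_{e\in E}2^{ -|e|+1}$ is the expected number of monochromatic edges when each vertex independently receives one of the two colors uniformly at random. -}

module Defs where

open import Data.Nat as ℕ using (ℕ; _∸_; _^_)
open import Data.Nat.Properties using (m^n≢0)
open import Data.Integer using (+_)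
open import Data.Rational using (ℚ; _/_; _+_; 0ℚ)
open import Data.Fin using (Fin)
open import Data.Fin.Subset using (Subset; _∈_; ∣_∣)
open import Data.List using (List; map; foldr)
open import Data.List.Relation.Unary.All using (All)
open import Data.Bool using (Bool; true; false)
open import Data.Product using (∃; _×_)
open import Relation.Binary.PropositionalEquality using (_≡_)

-- A hypergraph on vertex set V = Fin n is a list of edges (subsets of Fin n).
-- (Distinctness of edges and size ≥ 2 are imposed as hypotheses in the statement.)

edgeWeight : ∀ {n} → Subset n → ℚ
edgeWeight e = (+ 1 / (2 ^ (∣ e ∣ ∸ 1))) {{m^n≢0 2 (∣ e ∣ ∸ 1)}}

q : ∀ {n} → List (Subset n) → ℚ
q E = foldr _+_ 0ℚ (map edgeWeight E)

Coloring : ℕ → Set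
Coloring n = Fin n → Bool

Proper : ∀ {n} → Coloring n → List (Subset n) → Set
Proper {n} c E =
  All (λ e → (∃ λ (i : Fin n) → i ∈ e × c i ≡ true) × (∃ λ (j : Fin n) → j ∈ e × c j ≡ false)) E

TwoColorable : ∀ {n} → List (Subset n) → Set
TwoColorable {n} E = ∃ λ (c : Coloring n) → Proper c E

{-# OPTIONS --safe #-}
module Submission where

-- Pick the set σ of red vertices uniformly at random and go through the edges
-- in list order: an edge that is still entirely red switches one of its
-- vertices, chosen uniformly, to blue; blue edges are treated symmetrically.
-- Suppose f meets σ but ends up blue, its red vertices v₁, …, vᵣ being switched
-- in this order by e₁, …, eᵣ.  As eⱼ avoids v₁, …, vⱼ₋₁, it is red up to the
-- vertex vⱼ already for T = (σ \ f) ∪ {vⱼ₊₁, …, vᵣ}.  Reading the chain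
-- backwards from T = σ \ f, every link is one of the pairs (v, e) with v ∈ e
-- and e ⊆ T ∪ {v}, taken with weight 1/|e|.  The total weight of these pairs is
-- monotone in T and has mean q(H), so it is at most some M = O(log k) for most
-- σ, and restricted to such σ the chains with increasing edge indices sum to at
-- most 4ᴹ.  The first link costs an extra factor q(H)/k, so the expected number
-- of such edges f is at most q(H)² 4ᴹ / k, which is small for M ≤ (log k) / 4.

open import Defs

module Recoloring where

  open import Data.Bool using (Bool; true; false; _∧_; _∨_; not; T)
  open import Data.Bool.Properties using (∧-identityʳ; ∧-zeroʳ)
  open import Data.Fin using (Fin; zero; suc)
  import Data.Fin.Properties as Fin
  open import Data.Fin.Subset using (Subset; _∈_; ∣_∣; ∁)
  open import Data.Fin.Subset.Properties using (∣p∣≤n)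
  import Data.Integer as ℤ
  import Data.Integer.Properties as ℤ
  open import Data.Integer.Tactic.RingSolver using () renaming (solve-∀ to ℤ-solve-∀)
  open import Data.List using (List; []; _∷_; _++_; map; allFin; length)
  open import Data.List.Properties using (map-tabulate)
  open import Data.List.Relation.Unary.All as All using (All; []; _∷_)
  open import Data.Nat using (ℕ; zero; suc; _+_; _*_; _^_; _∸_; _≤_; _<_; _≤ᵇ_; z≤n; s≤s; NonZero; >-nonZero; >-nonZero⁻¹; ⌊_/2⌋; ⌈_/2⌉; _!)
  open import Data.Nat.DivMod using (_/_; _%_; m/n*n≡m; m/n*n≤m; m≥n⇒m/n>0; m≡m%n+[m/n]*n; m%n<n)
  open import Data.Nat.Divisibility using (_∣_; ∣-trans; m≤n⇒m!∣n!; m∣m*n; ∣m∣n⇒∣m+n)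
  open import Data.Nat.Logarithm using (⌊log₂_⌋; ⌊log₂⌋-mono-≤; ⌊log₂⌊n/2⌋⌋≡⌊log₂n⌋∸1)
  open import Data.Nat.Properties
  open import Data.Nat.Tactic.RingSolver using (solve-∀)
  open import Data.Product using (∃; _×_; _,_; proj₁; proj₂)
  import Data.Rational as ℚ
  import Data.Rational.Properties as ℚ
  import Data.Rational.Unnormalised as ℚᵘ
  import Data.Rational.Unnormalised.Properties as ℚᵘ
  open import Data.Unit using (tt)
  open import Data.Vec using ([]; _∷_; lookup; _[_]≔_)
  open import Data.Vec.Properties using (lookup∘update; lookup∘update′; []≔-commutes; lookup-map; lookup⇒[]=)
  open import Function using (_∘_; id)
  open import Relation.Binary.PropositionalEquality using (_≡_; refl; sym; trans; cong; cong₂; subst; subst₂; module ≡-Reasoning)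
  open import Relation.Nullary using (yes; no; ¬_; contradiction)

  private variable
    A C : Set
    n : ℕ

  -- Finite sums over lists.

  ∑ : List A → (A → ℕ) → ℕ
  ∑ []       f = 0
  ∑ (x ∷ xs) f = f x + ∑ xs f

  ∑-cong : ∀ (xs : List A) {f g : A → ℕ} → (∀ x → f x ≡ g x) → ∑ xs f ≡ ∑ xs g
  ∑-cong []       h = refl
  ∑-cong (x ∷ xs) h = cong₂ _+_ (h x) (∑-cong xs h)

  ∑-mono-All : ∀ {xs : List A} {f g : A → ℕ} → All (λ x → f x ≤ g x) xs → ∑ xs f ≤ ∑ xs g
  ∑-mono-All []       = z≤n
  ∑-mono-All (p ∷ ps) = +-mono-≤ p (∑-mono-All ps)

  ∑-mono : ∀ (xs : List A) {f g : A → ℕ} → (∀ x → f x ≤ g x) → ∑ xs f ≤ ∑ xs g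
  ∑-mono []       h = z≤n
  ∑-mono (x ∷ xs) h = +-mono-≤ (h x) (∑-mono xs h)

  +-interchange : ∀ a b c d → (a + b) + (c + d) ≡ (a + c) + (b + d)
  +-interchange = solve-∀

  ∑-+ : ∀ (xs : List A) (f g : A → ℕ) → ∑ xs (λ x → f x + g x) ≡ ∑ xs f + ∑ xs g
  ∑-+ []       f g = refl
  ∑-+ (x ∷ xs) f g = trans (cong (f x + g x +_) (∑-+ xs f g)) (+-interchange (f x) (g x) _ _)

  *-∑ : ∀ (xs : List A) a (f : A → ℕ) → a * ∑ xs f ≡ ∑ xs (λ x → a * f x)
  *-∑ []       a f = *-zeroʳ a
  *-∑ (x ∷ xs) a f = trans (*-distribˡ-+ a (f x) _) (cong (a * f x +_) (*-∑ xs a f))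

  ∑-* : ∀ (xs : List A) (f : A → ℕ) a → ∑ xs f * a ≡ ∑ xs (λ x → f x * a)
  ∑-* xs f a = trans (*-comm (∑ xs f) a) (trans (*-∑ xs a f) (∑-cong xs (λ x → *-comm a (f x))))

  ∑-zero : ∀ (xs : List A) → ∑ xs (λ _ → 0) ≡ 0
  ∑-zero []       = refl
  ∑-zero (x ∷ xs) = ∑-zero xs

  ∑-swap : ∀ (xs : List A) (ys : List C) (f : A → C → ℕ) →
           ∑ xs (λ x → ∑ ys (f x)) ≡ ∑ ys (λ y → ∑ xs (λ x → f x y))
  ∑-swap []       ys f = sym (∑-zero ys)
  ∑-swap (x ∷ xs) ys f =
    trans (cong (∑ ys (f x) +_) (∑-swap xs ys f)) (sym (∑-+ ys (f x) _))

  ∑-++ : ∀ (xs ys : List A) (f : A → ℕ) → ∑ (xs ++ ys) f ≡ ∑ xs f + ∑ ys f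
  ∑-++ []       ys f = refl
  ∑-++ (x ∷ xs) ys f = trans (cong (f x +_) (∑-++ xs ys f)) (sym (+-assoc (f x) _ _))

  ∑-map : ∀ (g : A → C) (xs : List A) (f : C → ℕ) → ∑ (map g xs) f ≡ ∑ xs (f ∘ g)
  ∑-map g []       f = refl
  ∑-map g (x ∷ xs) f = cong (f (g x) +_) (∑-map g xs f)

  ∑-<⇒∃ : ∀ (xs : List A) {f g : A → ℕ} → ∑ xs f < ∑ xs g → ∃ λ x → f x < g x
  ∑-<⇒∃ (x ∷ xs) {f} {g} lt with f x <? g x
  ... | yes p = x , p
  ... | no ¬p = ∑-<⇒∃ xs (≰⇒> λ q → <⇒≱ lt (+-mono-≤ (≮⇒≥ ¬p) q))

  ∑-allFin-suc : ∀ (f : Fin (suc n) → ℕ) → ∑ (allFin (suc n)) f ≡ f zero + ∑ (allFin n) (f ∘ suc)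
  ∑-allFin-suc {n} f =
    cong (f zero +_) (trans (cong (λ l → ∑ l f) (sym (map-tabulate id suc))) (∑-map suc (allFin n) f))

  -- Sums over the power set.

  subsets : ∀ n → List (Subset n)
  subsets zero    = [] ∷ []
  subsets (suc n) = map (true ∷_) (subsets n) ++ map (false ∷_) (subsets n)

  ∑-subsets-suc : ∀ (f : Subset (suc n) → ℕ) →
    ∑ (subsets (suc n)) f ≡ ∑ (subsets n) (f ∘ (true ∷_)) + ∑ (subsets n) (f ∘ (false ∷_))
  ∑-subsets-suc {n} f =
    trans (∑-++ (map (true ∷_) (subsets n)) _ f)
          (cong₂ _+_ (∑-map (true ∷_) (subsets n) f) (∑-map (false ∷_) (subsets n) f))

  double-* : ∀ a b → a * b + a * b ≡ (a + (a + 0)) * b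
  double-* = solve-∀

  ∑-subsets-const : ∀ n a → ∑ (subsets n) (λ _ → a) ≡ 2 ^ n * a
  ∑-subsets-const zero    a = refl
  ∑-subsets-const (suc n) a =
    trans (∑-subsets-suc {n} (λ _ → a))
          (trans (cong₂ _+_ (∑-subsets-const n a) (∑-subsets-const n a)) (double-* (2 ^ n) a))

  ∑-subsets-∁ : ∀ (f : Subset n → ℕ) → ∑ (subsets n) (f ∘ ∁) ≡ ∑ (subsets n) f
  ∑-subsets-∁ {zero}  f = refl
  ∑-subsets-∁ {suc n} f = begin
    ∑ (subsets (suc n)) (f ∘ ∁)
      ≡⟨ ∑-subsets-suc (f ∘ ∁) ⟩
    ∑ (subsets n) (f ∘ (false ∷_) ∘ ∁) + ∑ (subsets n) (f ∘ (true ∷_) ∘ ∁)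
      ≡⟨ cong₂ _+_ (∑-subsets-∁ (f ∘ (false ∷_))) (∑-subsets-∁ (f ∘ (true ∷_))) ⟩
    ∑ (subsets n) (f ∘ (false ∷_)) + ∑ (subsets n) (f ∘ (true ∷_))
      ≡⟨ +-comm (∑ (subsets n) (f ∘ (false ∷_))) _ ⟩
    ∑ (subsets n) (f ∘ (true ∷_)) + ∑ (subsets n) (f ∘ (false ∷_))
      ≡⟨ sym (∑-subsets-suc f) ⟩
    ∑ (subsets (suc n)) f ∎
    where open ≡-Reasoning

  ⟦_⟧ : Bool → ℕ
  ⟦ true  ⟧ = 1
  ⟦ false ⟧ = 0

  infixl 6 _⊕_ _⊖_
  _⊕_ _⊖_ : Subset n → Fin n → Subset n
  T ⊕ v = T [ v ]≔ true
  T ⊖ v = T [ v ]≔ false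

  -- Removing `v` is a bijection from the sets containing `v` onto the sets avoiding it. This passes
  -- from the red set before a switch to the red set after it.
  ∑-subsets-shift : ∀ (v : Fin n) (F : Subset n → Subset n → ℕ) →
    ∑ (subsets n) (λ U → ⟦ lookup U v ⟧ * F U (U ⊖ v)) ≡
    ∑ (subsets n) (λ T → ⟦ not (lookup T v) ⟧ * F (T ⊕ v) T)
  ∑-subsets-shift {suc n} zero F = begin
    ∑ (subsets (suc n)) (λ U → ⟦ lookup U zero ⟧ * F U (U ⊖ zero))
      ≡⟨ ∑-subsets-suc (λ U → ⟦ lookup U zero ⟧ * F U (U ⊖ zero)) ⟩
    ∑ (subsets n) (λ U → 1 * F (true ∷ U) (false ∷ U)) + ∑ (subsets n) (λ _ → 0)
      ≡⟨ +-comm (∑ (subsets n) (λ U → 1 * F (true ∷ U) (false ∷ U))) _ ⟩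
    ∑ (subsets n) (λ _ → 0) + ∑ (subsets n) (λ U → 1 * F (true ∷ U) (false ∷ U))
      ≡⟨ sym (∑-subsets-suc (λ T → ⟦ not (lookup T zero) ⟧ * F (T ⊕ zero) T)) ⟩
    ∑ (subsets (suc n)) (λ T → ⟦ not (lookup T zero) ⟧ * F (T ⊕ zero) T) ∎
    where open ≡-Reasoning
  ∑-subsets-shift {suc n} (suc v) F =
    trans (∑-subsets-suc (λ U → ⟦ lookup U (suc v) ⟧ * F U (U ⊖ suc v)))
    (trans (cong₂ _+_ (∑-subsets-shift v (λ U T → F (true ∷ U) (true ∷ T)))
                      (∑-subsets-shift v (λ U T → F (false ∷ U) (false ∷ T))))
           (sym (∑-subsets-suc (λ T → ⟦ not (lookup T (suc v)) ⟧ * F (T ⊕ suc v) T))))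

  ∑-members : ∀ (e : Subset n) → ∑ (allFin n) (λ v → ⟦ lookup e v ⟧) ≡ ∣ e ∣
  ∑-members []          = refl
  ∑-members (true  ∷ e) = trans (∑-allFin-suc (λ v → ⟦ lookup (true ∷ e) v ⟧)) (cong suc (∑-members e))
  ∑-members (false ∷ e) = trans (∑-allFin-suc (λ v → ⟦ lookup (false ∷ e) v ⟧)) (∑-members e)

  -- Containment, disjointness and monotonicity.

  infix 5 _⊆ᵇ_
  infix 4 _≼_

  -- Boolean and recursive on the vectors, so that they can serve as summands and be counted by
  -- induction on `n`; `_≼_` is the pointwise form used in arguments.
  _⊆ᵇ_ disjointᵇ : Subset n → Subset n → Bool
  []          ⊆ᵇ []      = true
  (false ∷ e) ⊆ᵇ (_ ∷ T) = e ⊆ᵇ T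
  (true  ∷ e) ⊆ᵇ (t ∷ T) = t ∧ (e ⊆ᵇ T)

  disjointᵇ []          []      = true
  disjointᵇ (false ∷ f) (_ ∷ T) = disjointᵇ f T
  disjointᵇ (true  ∷ f) (t ∷ T) = not t ∧ disjointᵇ f T

  ⊆ᵇ-lookup : ∀ (e T : Subset n) → e ⊆ᵇ T ≡ true → ∀ v → lookup e v ≡ true → lookup T v ≡ true
  ⊆ᵇ-lookup (true  ∷ e) (true ∷ T) p zero    q = refl
  ⊆ᵇ-lookup (true  ∷ e) (true ∷ T) p (suc v) q = ⊆ᵇ-lookup e T p v q
  ⊆ᵇ-lookup (false ∷ e) (_    ∷ T) p (suc v) q = ⊆ᵇ-lookup e T p v q

  lookup-⊆ᵇ : ∀ (e T : Subset n) → (∀ v → lookup e v ≡ true → lookup T v ≡ true) → e ⊆ᵇ T ≡ true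
  lookup-⊆ᵇ []          []      h = refl
  lookup-⊆ᵇ (false ∷ e) (_ ∷ T) h = lookup-⊆ᵇ e T (λ v → h (suc v))
  lookup-⊆ᵇ (true  ∷ e) (t ∷ T) h rewrite h zero refl = lookup-⊆ᵇ e T (λ v → h (suc v))

  _≼_ : Subset n → Subset n → Set
  T ≼ U = ∀ v → lookup T v ≡ true → lookup U v ≡ true

  update-mono : ∀ {T U : Subset n} v b → T ≼ U → (T [ v ]≔ b) ≼ (U [ v ]≔ b)
  update-mono {T = T} {U} v b h w p with w Fin.≟ v
  ... | yes refl = trans (lookup∘update w U b) (trans (sym (lookup∘update w T b)) p)
  ... | no  w≢v  = trans (lookup∘update′ w≢v U b) (h w (trans (sym (lookup∘update′ w≢v T b)) p))

  ≼-⊕ : ∀ (T : Subset n) v → T ≼ (T ⊕ v)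
  ≼-⊕ T v w p with w Fin.≟ v
  ... | yes refl = lookup∘update w T true
  ... | no  w≢v  = trans (lookup∘update′ w≢v T true) p

  ⊖-≼ : ∀ (T : Subset n) v → (T ⊖ v) ≼ T
  ⊖-≼ T v w p with w Fin.≟ v
  ... | yes refl with () ← trans (sym p) (lookup∘update w T false)
  ... | no  w≢v  = trans (sym (lookup∘update′ w≢v T false)) p

  ⟦⟧-mono : ∀ {a b} → (a ≡ true → b ≡ true) → ⟦ a ⟧ ≤ ⟦ b ⟧
  ⟦⟧-mono {false} h = z≤n
  ⟦⟧-mono {true}  h rewrite h refl = ≤-refl

  ⟦⟧≤1 : ∀ b → ⟦ b ⟧ ≤ 1
  ⟦⟧≤1 true  = ≤-refl
  ⟦⟧≤1 false = z≤n

  ⊆ᵇ-mono : ∀ (e : Subset n) {T U} → T ≼ U → e ⊆ᵇ T ≡ true → e ⊆ᵇ U ≡ true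
  ⊆ᵇ-mono e {T} {U} h p = lookup-⊆ᵇ e U (λ v q → h v (⊆ᵇ-lookup e T p v q))

  ∧-true : ∀ a {b} → a ∧ b ≡ true → a ≡ true × b ≡ true
  ∧-true true p = refl , p

  ∧-mono : ∀ {a b c d} → (a ≡ true → c ≡ true) → (b ≡ true → d ≡ true) → a ∧ b ≡ true → c ∧ d ≡ true
  ∧-mono {a} h k p with ∧-true a p
  ... | p₁ , p₂ rewrite h p₁ | k p₂ = refl

  -- Links of a chain of switches.

  -- The switches that can harm `f`: `e` is red in `U` and the switched vertex lies in `f` too.
  -- `completes` is the same event seen from `T = U ⊖ v`, the red set after the switch.
  hits : Subset n → Subset n → Subset n → Fin n → Bool
  hits f e U v = (e ⊆ᵇ U) ∧ (lookup e v ∧ lookup f v)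

  completes : Subset n → Subset n → Subset n → Fin n → ℕ
  completes f e T v = ⟦ not (lookup T v) ⟧ * ⟦ hits f e (T ⊕ v) v ⟧

  hits-inside : ∀ (f e U : Subset n) v → ⟦ hits f e U v ⟧ ≡ ⟦ lookup U v ⟧ * ⟦ hits f e U v ⟧
  hits-inside f e U v with hits f e U v in eq
  ... | false = sym (*-zeroʳ ⟦ lookup U v ⟧)
  ... | true with ∧-true (e ⊆ᵇ U) eq
  ... | p , q rewrite ⊆ᵇ-lookup e U p v (proj₁ (∧-true (lookup e v) q)) = refl

  -- An edge inside T is counted |e| times rather than once; this makes monotonicity
  -- in T immediate, and at most doubles the mean over T.
  near : Subset n → Subset n → ℕ
  near e T = ∑ (allFin _) (λ v → ⟦ (e ⊆ᵇ (T ⊕ v)) ∧ lookup e v ⟧)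

  near-mono : ∀ (e : Subset n) {T U} → T ≼ U → near e T ≤ near e U
  near-mono e {T} {U} h = ∑-mono (allFin _) (λ v →
    ⟦⟧-mono (∧-mono (⊆ᵇ-mono e (update-mono {T = T} {U} v true h)) id))

  completions : Subset n → Subset n → Subset n → ℕ
  completions f e T = ∑ (allFin _) (completes f e T)

  completes≤near : ∀ (f e T : Subset n) v → completes f e T v ≤ ⟦ (e ⊆ᵇ (T ⊕ v)) ∧ lookup e v ⟧
  completes≤near f e T v = begin
    ⟦ not (lookup T v) ⟧ * ⟦ hits f e (T ⊕ v) v ⟧
      ≤⟨ *-monoˡ-≤ ⟦ hits f e (T ⊕ v) v ⟧ (⟦⟧≤1 (not (lookup T v))) ⟩
    1 * ⟦ hits f e (T ⊕ v) v ⟧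
      ≡⟨ *-identityˡ _ ⟩
    ⟦ hits f e (T ⊕ v) v ⟧
      ≤⟨ ⟦⟧-mono (∧-mono id (λ p → proj₁ (∧-true (lookup e v) p))) ⟩
    ⟦ (e ⊆ᵇ (T ⊕ v)) ∧ lookup e v ⟧ ∎
    where open ≤-Reasoning

  -- The potential of an edge and its adjoint.

  -- Everything is kept in ℕ by scaling each edge's step by N: below, c e stands for
  -- N / |e|, and pot f es U / N ^ length es bounds the probability that processing es
  -- from the red set U switches all of U ∩ f.
  module Potential {n : ℕ} (N : ℕ) (c : Subset n → ℕ) where

    V : List (Fin n)
    V = allFin n

    P : List (Subset n)
    P = subsets n

    -- An upper bound for the exact transition, scaled by `N`. The unconditional term `N * φ U` pays
    -- both for an `e` that is not red and for a switch outside `f`.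
    step : Subset n → Subset n → (Subset n → ℕ) → Subset n → ℕ
    step f e φ U = N * φ U + c e * ∑ V (λ v → ⟦ hits f e U v ⟧ * φ (U ⊖ v))

    pot : Subset n → List (Subset n) → Subset n → ℕ
    pot f []       U = ⟦ disjointᵇ f U ⟧
    pot f (e ∷ es) U = step f e (pot f es) U

    -- The adjoint of step, which follows the chains of switches backwards in time.
    step* : Subset n → Subset n → (Subset n → ℕ) → Subset n → ℕ
    step* f e ψ T = N * ψ T + c e * ∑ V (λ v → completes f e T v * ψ (T ⊕ v))

    -- Transports a weight on initial red sets to a weight on final ones.
    pull : Subset n → (Subset n → ℕ) → List (Subset n) → Subset n → ℕ
    pull f ψ []       = ψ
    pull f ψ (e ∷ es) = pull f (step* f e ψ) es

    private
      expand : ∀ N c x y s → x * (N * y + c * s) ≡ N * (x * y) + c * (x * s)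
      expand = solve-∀

      expand* : ∀ N c x y s → (N * x + c * s) * y ≡ N * (x * y) + c * (s * y)
      expand* = solve-∀

      reorder : ∀ i x h y → x * (i * h * y) ≡ i * (x * (h * y))
      reorder = solve-∀

      reorder* : ∀ i x h y → i * (x * (h * y)) ≡ i * h * x * y
      reorder* = solve-∀

    -- The terms without a switch agree on both sides. A hit forces `v` into `U`, and this indicator
    -- is what `∑-subsets-shift` needs to substitute `U = T ⊕ v` in the others.
    step-adjoint : ∀ f e φ ψ → ∑ P (λ U → ψ U * step f e φ U) ≡ ∑ P (λ T → step* f e ψ T * φ T)
    step-adjoint f e φ ψ = begin
      ∑ P (λ U → ψ U * step f e φ U)
        ≡⟨ ∑-cong P (λ U → expand N (c e) (ψ U) (φ U) _) ⟩
      ∑ P (λ U → N * (ψ U * φ U) + c e * (ψ U * ∑ V (λ v → ⟦ hits f e U v ⟧ * φ (U ⊖ v))))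
        ≡⟨ ∑-+ P _ _ ⟩
      ∑ P (λ U → N * (ψ U * φ U)) + ∑ P (λ U → c e * (ψ U * ∑ V (λ v → ⟦ hits f e U v ⟧ * φ (U ⊖ v))))
        ≡⟨ cong (∑ P (λ U → N * (ψ U * φ U)) +_) second ⟩
      ∑ P (λ T → N * (ψ T * φ T)) + ∑ P (λ T → c e * (∑ V (λ v → completes f e T v * ψ (T ⊕ v)) * φ T))
        ≡⟨ sym (∑-+ P _ _) ⟩
      ∑ P (λ T → N * (ψ T * φ T) + c e * (∑ V (λ v → completes f e T v * ψ (T ⊕ v)) * φ T))
        ≡⟨ ∑-cong P (λ T → sym (expand* N (c e) (ψ T) (φ T) _)) ⟩
      ∑ P (λ T → step* f e ψ T * φ T) ∎
      where
      open ≡-Reasoning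
      second : ∑ P (λ U → c e * (ψ U * ∑ V (λ v → ⟦ hits f e U v ⟧ * φ (U ⊖ v)))) ≡
               ∑ P (λ T → c e * (∑ V (λ v → completes f e T v * ψ (T ⊕ v)) * φ T))
      second = begin
        ∑ P (λ U → c e * (ψ U * ∑ V (λ v → ⟦ hits f e U v ⟧ * φ (U ⊖ v))))
          ≡⟨ sym (*-∑ P (c e) _) ⟩
        c e * ∑ P (λ U → ψ U * ∑ V (λ v → ⟦ hits f e U v ⟧ * φ (U ⊖ v)))
          ≡⟨ cong (c e *_) (∑-cong P (λ U → *-∑ V (ψ U) _)) ⟩
        c e * ∑ P (λ U → ∑ V (λ v → ψ U * (⟦ hits f e U v ⟧ * φ (U ⊖ v))))
          ≡⟨ cong (c e *_) (∑-swap P V _) ⟩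
        c e * ∑ V (λ v → ∑ P (λ U → ψ U * (⟦ hits f e U v ⟧ * φ (U ⊖ v))))
          ≡⟨ cong (c e *_) (∑-cong V (λ v → ∑-cong P (λ U →
               trans (cong (λ h → ψ U * (h * φ (U ⊖ v))) (hits-inside f e U v))
                     (reorder ⟦ lookup U v ⟧ (ψ U) _ _)))) ⟩
        c e * ∑ V (λ v → ∑ P (λ U → ⟦ lookup U v ⟧ * (ψ U * (⟦ hits f e U v ⟧ * φ (U ⊖ v)))))
          ≡⟨ cong (c e *_) (∑-cong V (λ v →
               ∑-subsets-shift v (λ U T → ψ U * (⟦ hits f e U v ⟧ * φ T)))) ⟩
        c e * ∑ V (λ v → ∑ P (λ T → ⟦ not (lookup T v) ⟧ * (ψ (T ⊕ v) * (⟦ hits f e (T ⊕ v) v ⟧ * φ T))))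
          ≡⟨ cong (c e *_) (∑-cong V (λ v → ∑-cong P (λ T → reorder* ⟦ not (lookup T v) ⟧ _ _ _))) ⟩
        c e * ∑ V (λ v → ∑ P (λ T → completes f e T v * ψ (T ⊕ v) * φ T))
          ≡⟨ cong (c e *_) (∑-swap V P _) ⟩
        c e * ∑ P (λ T → ∑ V (λ v → completes f e T v * ψ (T ⊕ v) * φ T))
          ≡⟨ cong (c e *_) (∑-cong P (λ T → sym (∑-* V _ (φ T)))) ⟩
        c e * ∑ P (λ T → ∑ V (λ v → completes f e T v * ψ (T ⊕ v)) * φ T)
          ≡⟨ *-∑ P (c e) _ ⟩
        ∑ P (λ T → c e * (∑ V (λ v → completes f e T v * ψ (T ⊕ v)) * φ T)) ∎

    pull-adjoint : ∀ f es ψ → ∑ P (λ U → ψ U * pot f es U) ≡ ∑ P (λ T → pull f ψ es T * ⟦ disjointᵇ f T ⟧)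
    pull-adjoint f []       ψ = refl
    pull-adjoint f (e ∷ es) ψ = trans (step-adjoint f e (pot f es) ψ) (pull-adjoint f es (step* f e ψ))

    -- Divided by `N ^ length es` and expanded, this product sums the weights of all chains with
    -- increasing edge indices, every link being measured at the same set `T`.
    load : List (Subset n) → Subset n → ℕ
    load []       T = 1
    load (e ∷ es) T = (N + c e * near e T) * load es T

    load-mono : ∀ es {T U} → T ≼ U → load es T ≤ load es U
    load-mono []       h = ≤-refl
    load-mono (e ∷ es) h = *-mono-≤ (+-monoʳ-≤ N (*-monoʳ-≤ (c e) (near-mono e h))) (load-mono es h)

    N^length≤load : ∀ es T → N ^ length es ≤ load es T
    N^length≤load []       T = ≤-refl
    N^length≤load (e ∷ es) T = *-mono-≤ (m≤m+n N _) (N^length≤load es T)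

    module _ {K : ℕ} where

      -- Since `load` is monotone, the hypothesis at `T ⊕ v` also bounds `ψ (T ⊕ v)` times the load
      -- at `T`. Adding the links through `e` then costs the factor `N + c e * near e T`, which is
      -- exactly the factor that `load` loses when `e` leaves the list.
      step*-load : ∀ f e es ψ → .{{NonZero N}} → (∀ T → ψ T * load (e ∷ es) T ≤ K) →
                   ∀ T → step* f e ψ T * load es T ≤ K
      step*-load f e es ψ h T = *-cancelˡ-≤ (N + c e * near e T) {{>-nonZero (≤-trans (>-nonZero⁻¹ N) (m≤m+n N _))}} (begin
        (N + c e * near e T) * (step* f e ψ T * load es T)
          ≡⟨ regroup (N + c e * near e T) N (ψ T) (c e) _ (load es T) ⟩
        N * (ψ T * Λ) + c e * (∑ V (λ v → completes f e T v * ψ (T ⊕ v)) * Λ)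
          ≡⟨ cong (λ s → N * (ψ T * Λ) + c e * s) (∑-* V _ Λ) ⟩
        N * (ψ T * Λ) + c e * ∑ V (λ v → completes f e T v * ψ (T ⊕ v) * Λ)
          ≤⟨ +-mono-≤ (*-monoʳ-≤ N (h T)) (*-monoʳ-≤ (c e) (∑-mono V (λ v → begin
               completes f e T v * ψ (T ⊕ v) * Λ
                 ≡⟨ *-assoc (completes f e T v) _ _ ⟩
               completes f e T v * (ψ (T ⊕ v) * Λ)
                 ≤⟨ *-mono-≤ (completes≤near f e T v)
                      (≤-trans (*-monoʳ-≤ (ψ (T ⊕ v)) (load-mono (e ∷ es) (≼-⊕ T v))) (h (T ⊕ v))) ⟩
               ⟦ (e ⊆ᵇ (T ⊕ v)) ∧ lookup e v ⟧ * K ∎))) ⟩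
        N * K + c e * ∑ V (λ v → ⟦ (e ⊆ᵇ (T ⊕ v)) ∧ lookup e v ⟧ * K)
          ≡⟨ cong (λ s → N * K + c e * s) (sym (∑-* V _ K)) ⟩
        N * K + c e * (near e T * K)
          ≡⟨ factor N K (c e) (near e T) ⟩
        (N + c e * near e T) * K ∎)
        where
        open ≤-Reasoning
        Λ = load (e ∷ es) T
        regroup : ∀ a N p c s l → a * ((N * p + c * s) * l) ≡ N * (p * (a * l)) + c * (s * (a * l))
        regroup = solve-∀
        factor : ∀ N K c m → N * K + c * (m * K) ≡ (N + c * m) * K
        factor = solve-∀

      -- Chains ending in `T` are sorted by the edge `e` that switched last. That link keeps its own
      -- weight `c e * completions f e T`, to be averaged over `T` later; all earlier links together
      -- contribute at most `K`. The first summand is the empty chain.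
      pull-bound : ∀ f es ψ → .{{NonZero N}} → (∀ T → ψ T * load es T ≤ K) → ∀ T →
        N * pull f ψ es T ≤ N ^ suc (length es) * ψ T + K * ∑ es (λ e → c e * completions f e T)
      pull-bound f []       ψ h T = ≤-reflexive (lem N (ψ T) K)
        where
        lem : ∀ N p K → N * p ≡ N * 1 * p + K * 0
        lem = solve-∀
      pull-bound f (e ∷ es) ψ h T = begin
        N * pull f (step* f e ψ) es T
          ≤⟨ pull-bound f es (step* f e ψ) (step*-load f e es ψ h) T ⟩
        N ^ suc (length es) * step* f e ψ T + K * R
          ≡⟨ cong (_+ K * R) (regroup (N ^ suc (length es)) N (ψ T) (c e) _) ⟩
        N ^ suc (suc (length es)) * ψ T
          + c e * (∑ V (λ v → completes f e T v * ψ (T ⊕ v)) * N ^ suc (length es)) + K * R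
          ≤⟨ +-monoˡ-≤ (K * R) (+-monoʳ-≤ (N ^ suc (suc (length es)) * ψ T) (*-monoʳ-≤ (c e) inner)) ⟩
        N ^ suc (suc (length es)) * ψ T + c e * (completions f e T * K) + K * R
          ≡⟨ factor (N ^ suc (suc (length es)) * ψ T) (c e) _ K R ⟩
        N ^ suc (suc (length es)) * ψ T + K * (c e * completions f e T + R) ∎
        where
        open ≤-Reasoning
        R = ∑ es (λ e → c e * completions f e T)
        regroup : ∀ a N p c s → a * (N * p + c * s) ≡ N * a * p + c * (s * a)
        regroup = solve-∀
        factor : ∀ x c m K R → x + c * (m * K) + K * R ≡ x + K * (c * m + R)
        factor = solve-∀
        inner : ∑ V (λ v → completes f e T v * ψ (T ⊕ v)) * N ^ suc (length es) ≤ completions f e T * K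
        inner = begin
          ∑ V (λ v → completes f e T v * ψ (T ⊕ v)) * N ^ suc (length es)
            ≡⟨ ∑-* V _ _ ⟩
          ∑ V (λ v → completes f e T v * ψ (T ⊕ v) * N ^ suc (length es))
            -- Each factor `N` is at most the matching factor of `load`, so the hypothesis applies
            -- at `T ⊕ v`.
            ≤⟨ ∑-mono V (λ v → ≤-trans (≤-reflexive (*-assoc (completes f e T v) _ _))
                 (*-monoʳ-≤ (completes f e T v)
                   (≤-trans (*-monoʳ-≤ (ψ (T ⊕ v)) (N^length≤load (e ∷ es) (T ⊕ v))) (h (T ⊕ v))))) ⟩
          ∑ V (λ v → completes f e T v * K)
            ≡⟨ sym (∑-* V _ K) ⟩
          completions f e T * K ∎

  -- Choosing the switches by conditional expectations.

  ⊖-comm : ∀ (U : Subset n) v w → U ⊖ v ⊖ w ≡ U ⊖ w ⊖ v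
  ⊖-comm U v w with v Fin.≟ w
  ... | yes refl = refl
  ... | no  v≢w  = []≔-commutes U v w v≢w

  disjointᵇ-⊖ : ∀ (f U : Subset n) v → lookup f v ≡ false → disjointᵇ f (U ⊖ v) ≡ disjointᵇ f U
  disjointᵇ-⊖ (false ∷ f) (u ∷ U) zero    p = refl
  disjointᵇ-⊖ (false ∷ f) (u ∷ U) (suc v) p = disjointᵇ-⊖ f U v p
  disjointᵇ-⊖ (true  ∷ f) (u ∷ U) (suc v) p = cong (not u ∧_) (disjointᵇ-⊖ f U v p)

  module Process {n : ℕ} (N : ℕ) (c : Subset n → ℕ) where
    open Potential N c

    -- A switch outside `f` leaves the trace on `f` unchanged and can only make fewer edges red,
    -- hence fewer hits later on.
    pot-⊖ : ∀ f es U v → lookup f v ≡ false → pot f es (U ⊖ v) ≤ pot f es U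
    pot-⊖ f []       U v p = ≤-reflexive (cong ⟦_⟧ (disjointᵇ-⊖ f U v p))
    pot-⊖ f (e ∷ es) U v p =
      +-mono-≤ (*-monoʳ-≤ N (pot-⊖ f es U v p)) (*-monoʳ-≤ (c e) (∑-mono V (λ w →
        *-mono-≤ (⟦⟧-mono (∧-mono (⊆ᵇ-mono e {U ⊖ v} {U} (⊖-≼ U v)) id))
                 (≤-trans (≤-reflexive (cong (pot f es) (⊖-comm U v w))) (pot-⊖ f es (U ⊖ w) v p)))))

    -- A vertex of `e` inside `f` is a hit and occurs in the sum of `step`. A vertex outside `f` is
    -- charged to `pot f es S` by `pot-⊖`; the charges number at most `c e * ∣ e ∣ = N`, the first
    -- term of `step`.
    average≤pot : ∀ f e es S → c e * ∣ e ∣ ≡ N → e ⊆ᵇ S ≡ true →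
      ∑ V (λ v → ⟦ lookup e v ⟧ * (c e * pot f es (S ⊖ v))) ≤ pot f (e ∷ es) S
    average≤pot f e es S cN e⊆S = begin
      ∑ V (λ v → ⟦ lookup e v ⟧ * (c e * pot f es (S ⊖ v)))
        ≤⟨ ∑-mono V pointwise ⟩
      ∑ V (λ v → ⟦ lookup e v ⟧ * (c e * pot f es S) + c e * (⟦ hits f e S v ⟧ * pot f es (S ⊖ v)))
        ≡⟨ ∑-+ V _ _ ⟩
      ∑ V (λ v → ⟦ lookup e v ⟧ * (c e * pot f es S)) + ∑ V (λ v → c e * (⟦ hits f e S v ⟧ * pot f es (S ⊖ v)))
        ≡⟨ cong₂ _+_ (sym (∑-* V _ _)) (sym (*-∑ V (c e) _)) ⟩
      ∑ V (λ v → ⟦ lookup e v ⟧) * (c e * pot f es S) + c e * ∑ V (λ v → ⟦ hits f e S v ⟧ * pot f es (S ⊖ v))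
        ≡⟨ cong (_+ c e * ∑ V (λ v → ⟦ hits f e S v ⟧ * pot f es (S ⊖ v)))
             (trans (cong (_* (c e * pot f es S)) (∑-members e))
             (trans (assoc′ ∣ e ∣ (c e) _) (cong (_* pot f es S) cN))) ⟩
      pot f (e ∷ es) S ∎
      where
      open ≤-Reasoning
      assoc′ : ∀ a b x → a * (b * x) ≡ b * a * x
      assoc′ = solve-∀
      pointwise : ∀ v → ⟦ lookup e v ⟧ * (c e * pot f es (S ⊖ v)) ≤
        ⟦ lookup e v ⟧ * (c e * pot f es S) + c e * (⟦ hits f e S v ⟧ * pot f es (S ⊖ v))
      pointwise v rewrite e⊆S with lookup e v | lookup f v in fv
      ... | false | _     = z≤n
      ... | true  | true  = ≤-trans (≤-reflexive (lem (c e) _)) (m≤n+m _ _)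
        where
        lem : ∀ c x → 1 * (c * x) ≡ c * (1 * x)
        lem = solve-∀
      ... | true  | false = ≤-trans (*-monoʳ-≤ 1 (*-monoʳ-≤ (c e) (pot-⊖ f es S v fv))) (m≤m+n _ _)

    -- Derandomisation: the invariant is that the weighted potential stays below `N` to the number
    -- of edges left. At the end it is a natural number below 1, so no `f` of positive weight has
    -- lost all its red vertices.
    greedy : ∀ (b : Subset n → ℕ) fs es S → All (λ e → c e * ∣ e ∣ ≡ N) es →
      ∑ fs (λ f → b f * pot f es S) < N ^ length es →
      ∃ λ S′ → S′ ≼ S × All (λ e → ¬ (e ≼ S′)) es × ∑ fs (λ f → b f * ⟦ disjointᵇ f S′ ⟧) < 1
    greedy b fs []       S []         lt = S , (λ _ p → p) , [] , lt
    greedy b fs (e ∷ es) S (cN ∷ cNs) lt = go (e ⊆ᵇ S) refl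
      where
      open ≤-Reasoning
      Φ : Subset n → ℕ
      Φ U = ∑ fs (λ f → b f * pot f es U)
      Goal = ∃ λ S′ → S′ ≼ S × All (λ e′ → ¬ (e′ ≼ S′)) (e ∷ es) ×
                      ∑ fs (λ f → b f * ⟦ disjointᵇ f S′ ⟧) < 1
      reorder₁ : ∀ N b x → N * (b * x) ≡ b * (N * x)
      reorder₁ = solve-∀
      reorder₂ : ∀ i c b x → i * (c * (b * x)) ≡ b * (i * (c * x))
      reorder₂ = solve-∀
      N*Φ≤ : N * Φ S ≤ ∑ fs (λ f → b f * pot f (e ∷ es) S)
      N*Φ≤ = begin
        N * Φ S
          ≡⟨ *-∑ fs N _ ⟩
        ∑ fs (λ f → N * (b f * pot f es S))
          ≤⟨ ∑-mono fs (λ f → ≤-trans (≤-reflexive (reorder₁ N (b f) _)) (*-monoʳ-≤ (b f) (m≤m+n _ _))) ⟩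
        ∑ fs (λ f → b f * pot f (e ∷ es) S) ∎
      averageΦ : e ⊆ᵇ S ≡ true → ∑ V (λ v → ⟦ lookup e v ⟧ * (c e * Φ (S ⊖ v))) <
                                 ∑ V (λ v → ⟦ lookup e v ⟧ * (c e * N ^ length es))
      averageΦ e⊆S = begin-strict
        ∑ V (λ v → ⟦ lookup e v ⟧ * (c e * Φ (S ⊖ v)))
          ≡⟨ ∑-cong V (λ v → trans (cong (⟦ lookup e v ⟧ *_) (*-∑ fs (c e) _)) (*-∑ fs ⟦ lookup e v ⟧ _)) ⟩
        ∑ V (λ v → ∑ fs (λ f → ⟦ lookup e v ⟧ * (c e * (b f * pot f es (S ⊖ v)))))
          ≡⟨ ∑-swap V fs _ ⟩
        ∑ fs (λ f → ∑ V (λ v → ⟦ lookup e v ⟧ * (c e * (b f * pot f es (S ⊖ v)))))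
          ≡⟨ ∑-cong fs (λ f → trans (∑-cong V (λ v → reorder₂ ⟦ lookup e v ⟧ (c e) (b f) _)) (sym (*-∑ V (b f) _))) ⟩
        ∑ fs (λ f → b f * ∑ V (λ v → ⟦ lookup e v ⟧ * (c e * pot f es (S ⊖ v))))
          ≤⟨ ∑-mono fs (λ f → *-monoʳ-≤ (b f) (average≤pot f e es S cN e⊆S)) ⟩
        ∑ fs (λ f → b f * pot f (e ∷ es) S)
          <⟨ lt ⟩
        -- `N` is split into one share `c e` per vertex of `e`, so that both sides can be compared
        -- vertex by vertex.
        N * N ^ length es
          ≡⟨ cong (_* N ^ length es) (trans (sym cN) (trans (*-comm (c e) _) (cong (_* c e) (sym (∑-members e))))) ⟩
        ∑ V (λ v → ⟦ lookup e v ⟧) * c e * N ^ length es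
          ≡⟨ trans (*-assoc (∑ V (λ v → ⟦ lookup e v ⟧)) (c e) _) (∑-* V (λ v → ⟦ lookup e v ⟧) _) ⟩
        ∑ V (λ v → ⟦ lookup e v ⟧ * (c e * N ^ length es)) ∎
      extract : ∀ i m {x y} → ⟦ i ⟧ * (m * x) < ⟦ i ⟧ * (m * y) → i ≡ true × x < y
      extract true m {x} {y} p = refl , *-cancelˡ-< m x y (*-cancelˡ-< 1 (m * x) (m * y) p)
      go : ∀ s → e ⊆ᵇ S ≡ s → Goal
      -- An edge that is not red is skipped; red sets only shrink, so it stays broken.
      go false e⊈S =
        let S′ , S′≼S , av , z = greedy b fs es S cNs (*-cancelˡ-< N _ _ (≤-<-trans N*Φ≤ lt))
            e⋠S′ e≼S′ = contradiction (trans (sym e⊈S) (lookup-⊆ᵇ e S (λ v p → S′≼S v (e≼S′ v p)))) λ ()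
        in  S′ , S′≼S , e⋠S′ ∷ av , z
      go true e⊆S =
        let v , lt′ = ∑-<⇒∃ V (averageΦ e⊆S)
            v∈e , lt″ = extract (lookup e v) (c e) lt′
            S′ , S′≼S⊖v , av , z = greedy b fs es (S ⊖ v) cNs lt″
            e⋠S′ e≼S′ = contradiction (trans (sym (S′≼S⊖v v (e≼S′ v v∈e))) (lookup∘update v S false)) λ ()
        in  S′ , (λ w p → ⊖-≼ S v w (S′≼S⊖v w p)) , e⋠S′ ∷ av , z

  -- Counting: means of `near` and of `completions`.

  ∑-supersets : ∀ (e : Subset n) → ∑ (subsets n) (λ T → ⟦ e ⊆ᵇ T ⟧) * 2 ^ ∣ e ∣ ≡ 2 ^ n
  ∑-supersets [] = refl
  ∑-supersets {suc n} (true ∷ e) = begin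
    ∑ (subsets (suc n)) (λ T → ⟦ (true ∷ e) ⊆ᵇ T ⟧) * (2 * 2 ^ ∣ e ∣)
      ≡⟨ cong (_* (2 * 2 ^ ∣ e ∣)) (trans (∑-subsets-suc (λ T → ⟦ (true ∷ e) ⊆ᵇ T ⟧))
           (trans (cong (s +_) (∑-zero (subsets n))) (+-identityʳ s))) ⟩
    s * (2 * 2 ^ ∣ e ∣)
      ≡⟨ lem s (2 ^ ∣ e ∣) ⟩
    2 * (s * 2 ^ ∣ e ∣)
      ≡⟨ cong (2 *_) (∑-supersets e) ⟩
    2 * 2 ^ n ∎
    where
    open ≡-Reasoning
    s = ∑ (subsets n) (λ T → ⟦ e ⊆ᵇ T ⟧)
    lem : ∀ s a → s * (2 * a) ≡ 2 * (s * a)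
    lem = solve-∀
  ∑-supersets {suc n} (false ∷ e) = begin
    ∑ (subsets (suc n)) (λ T → ⟦ (false ∷ e) ⊆ᵇ T ⟧) * 2 ^ ∣ e ∣
      ≡⟨ cong (_* 2 ^ ∣ e ∣) (∑-subsets-suc (λ T → ⟦ (false ∷ e) ⊆ᵇ T ⟧)) ⟩
    (s + s) * 2 ^ ∣ e ∣
      ≡⟨ lem s (2 ^ ∣ e ∣) ⟩
    2 * (s * 2 ^ ∣ e ∣)
      ≡⟨ cong (2 *_) (∑-supersets e) ⟩
    2 * 2 ^ n ∎
    where
    open ≡-Reasoning
    s = ∑ (subsets n) (λ T → ⟦ e ⊆ᵇ T ⟧)
    lem : ∀ s a → (s + s) * a ≡ 2 * (s * a)
    lem = solve-∀

  -- For `v` in `e` the coordinate of `T` at `v` is free, so there are twice as many such `T` as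
  -- supersets of `e`.
  ∑-supersets-but : ∀ (e : Subset n) v →
    ∑ (subsets n) (λ T → ⟦ (e ⊆ᵇ (T ⊕ v)) ∧ lookup e v ⟧) * 2 ^ ∣ e ∣ ≡ ⟦ lookup e v ⟧ * (2 * 2 ^ n)
  ∑-supersets-but {suc n} (true ∷ e) zero = begin
    ∑ (subsets (suc n)) (λ T → ⟦ ((true ∷ e) ⊆ᵇ (T ⊕ zero)) ∧ true ⟧) * (2 * 2 ^ ∣ e ∣)
      ≡⟨ cong (_* (2 * 2 ^ ∣ e ∣)) (∑-cong (subsets (suc n)) {g = λ T → ⟦ (true ∷ e) ⊆ᵇ (T ⊕ zero) ⟧}
           (λ T → cong ⟦_⟧ (∧-identityʳ ((true ∷ e) ⊆ᵇ (T ⊕ zero))))) ⟩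
    ∑ (subsets (suc n)) (λ T → ⟦ (true ∷ e) ⊆ᵇ (T ⊕ zero) ⟧) * (2 * 2 ^ ∣ e ∣)
      ≡⟨ cong (_* (2 * 2 ^ ∣ e ∣)) (∑-subsets-suc (λ T → ⟦ (true ∷ e) ⊆ᵇ (T ⊕ zero) ⟧)) ⟩
    (s + s) * (2 * 2 ^ ∣ e ∣)
      ≡⟨ lem s (2 ^ ∣ e ∣) ⟩
    1 * (2 * (2 * (s * 2 ^ ∣ e ∣)))
      ≡⟨ cong (λ x → 1 * (2 * (2 * x))) (∑-supersets e) ⟩
    1 * (2 * (2 * 2 ^ n)) ∎
    where
    open ≡-Reasoning
    s = ∑ (subsets n) (λ T → ⟦ e ⊆ᵇ T ⟧)
    lem : ∀ s a → (s + s) * (2 * a) ≡ 1 * (2 * (2 * (s * a)))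
    lem = solve-∀
  ∑-supersets-but {suc n} (false ∷ e) zero =
    cong (_* 2 ^ ∣ e ∣) (trans (∑-cong (subsets (suc n)) {g = λ _ → 0}
      (λ T → cong ⟦_⟧ (∧-zeroʳ ((false ∷ e) ⊆ᵇ (T ⊕ zero))))) (∑-zero (subsets (suc n))))
  ∑-supersets-but {suc n} (true ∷ e) (suc v) = begin
    ∑ (subsets (suc n)) (λ T → ⟦ ((true ∷ e) ⊆ᵇ (T ⊕ suc v)) ∧ lookup e v ⟧) * (2 * 2 ^ ∣ e ∣)
      ≡⟨ cong (_* (2 * 2 ^ ∣ e ∣)) (trans (∑-subsets-suc (λ T → ⟦ ((true ∷ e) ⊆ᵇ (T ⊕ suc v)) ∧ lookup e v ⟧))
           (trans (cong (s +_) (∑-zero (subsets n))) (+-identityʳ s))) ⟩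
    s * (2 * 2 ^ ∣ e ∣)
      ≡⟨ lem s (2 ^ ∣ e ∣) ⟩
    2 * (s * 2 ^ ∣ e ∣)
      ≡⟨ cong (2 *_) (∑-supersets-but e v) ⟩
    2 * (⟦ lookup e v ⟧ * (2 * 2 ^ n))
      ≡⟨ lem′ ⟦ lookup e v ⟧ (2 ^ n) ⟩
    ⟦ lookup e v ⟧ * (2 * (2 * 2 ^ n)) ∎
    where
    open ≡-Reasoning
    s = ∑ (subsets n) (λ T → ⟦ (e ⊆ᵇ (T ⊕ v)) ∧ lookup e v ⟧)
    lem : ∀ s a → s * (2 * a) ≡ 2 * (s * a)
    lem = solve-∀
    lem′ : ∀ i a → 2 * (i * (2 * a)) ≡ i * (2 * (2 * a))
    lem′ = solve-∀
  ∑-supersets-but {suc n} (false ∷ e) (suc v) = begin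
    ∑ (subsets (suc n)) (λ T → ⟦ ((false ∷ e) ⊆ᵇ (T ⊕ suc v)) ∧ lookup e v ⟧) * 2 ^ ∣ e ∣
      ≡⟨ cong (_* 2 ^ ∣ e ∣) (∑-subsets-suc (λ T → ⟦ ((false ∷ e) ⊆ᵇ (T ⊕ suc v)) ∧ lookup e v ⟧)) ⟩
    (s + s) * 2 ^ ∣ e ∣
      ≡⟨ lem s (2 ^ ∣ e ∣) ⟩
    2 * (s * 2 ^ ∣ e ∣)
      ≡⟨ cong (2 *_) (∑-supersets-but e v) ⟩
    2 * (⟦ lookup e v ⟧ * (2 * 2 ^ n))
      ≡⟨ lem′ ⟦ lookup e v ⟧ (2 ^ n) ⟩
    ⟦ lookup e v ⟧ * (2 * (2 * 2 ^ n)) ∎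
    where
    open ≡-Reasoning
    s = ∑ (subsets n) (λ T → ⟦ (e ⊆ᵇ (T ⊕ v)) ∧ lookup e v ⟧)
    lem : ∀ s a → (s + s) * a ≡ 2 * (s * a)
    lem = solve-∀
    lem′ : ∀ i a → 2 * (i * (2 * a)) ≡ i * (2 * (2 * a))
    lem′ = solve-∀

  -- Divided by the size of `e`, the mean of `near e` is the contribution of `e` to `q`.
  ∑-near : ∀ (e : Subset n) → ∑ (subsets n) (near e) * 2 ^ ∣ e ∣ ≡ ∣ e ∣ * (2 * 2 ^ n)
  ∑-near {n} e = begin
    ∑ (subsets n) (near e) * 2 ^ ∣ e ∣
      ≡⟨ cong (_* 2 ^ ∣ e ∣) (∑-swap (subsets n) (allFin n) _) ⟩
    ∑ (allFin n) (λ v → ∑ (subsets n) (λ T → ⟦ (e ⊆ᵇ (T ⊕ v)) ∧ lookup e v ⟧)) * 2 ^ ∣ e ∣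
      ≡⟨ ∑-* (allFin n) _ _ ⟩
    ∑ (allFin n) (λ v → ∑ (subsets n) (λ T → ⟦ (e ⊆ᵇ (T ⊕ v)) ∧ lookup e v ⟧) * 2 ^ ∣ e ∣)
      ≡⟨ ∑-cong (allFin n) (∑-supersets-but e) ⟩
    ∑ (allFin n) (λ v → ⟦ lookup e v ⟧ * (2 * 2 ^ n))
      ≡⟨ sym (∑-* (allFin n) _ _) ⟩
    ∑ (allFin n) (λ v → ⟦ lookup e v ⟧) * (2 * 2 ^ n)
      ≡⟨ cong (_* (2 * 2 ^ n)) (∑-members e) ⟩
    ∣ e ∣ * (2 * 2 ^ n) ∎
    where open ≡-Reasoning

  separations : Subset n → Subset n → ℕ
  separations f e = ∑ (subsets _) (λ T → ⟦ e ⊆ᵇ T ⟧ * ⟦ disjointᵇ f T ⟧)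

  ∑-subsets-split : ∀ {F : Subset (suc n) → ℕ} {G H : Subset n → ℕ} →
    (∀ T → F (true ∷ T) ≡ G T) → (∀ T → F (false ∷ T) ≡ H T) →
    ∑ (subsets (suc n)) F ≡ ∑ (subsets n) G + ∑ (subsets n) H
  ∑-subsets-split {n} {F} p q = trans (∑-subsets-suc F) (cong₂ _+_ (∑-cong (subsets n) p) (∑-cong (subsets n) q))

  -- If `e` and `f` are disjoint, the two conditions fix one coordinate per vertex of either edge;
  -- if they share a vertex, the conditions exclude each other.
  separations-bound : ∀ (f e : Subset n) → separations f e * (2 ^ ∣ e ∣ * 2 ^ ∣ f ∣) ≤ 2 ^ n
  separations-bound [] [] = ≤-refl
  separations-bound {suc n} (false ∷ f) (false ∷ e) = begin
    separations (false ∷ f) (false ∷ e) * (2 ^ ∣ e ∣ * 2 ^ ∣ f ∣)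
      ≡⟨ cong (_* (2 ^ ∣ e ∣ * 2 ^ ∣ f ∣)) (∑-subsets-suc (λ T → ⟦ (false ∷ e) ⊆ᵇ T ⟧ * ⟦ disjointᵇ (false ∷ f) T ⟧)) ⟩
    (s + s) * (2 ^ ∣ e ∣ * 2 ^ ∣ f ∣)
      ≡⟨ lem s (2 ^ ∣ e ∣ * 2 ^ ∣ f ∣) ⟩
    2 * (s * (2 ^ ∣ e ∣ * 2 ^ ∣ f ∣))
      ≤⟨ *-monoʳ-≤ 2 (separations-bound f e) ⟩
    2 * 2 ^ n ∎
    where
    open ≤-Reasoning
    s = separations f e
    lem : ∀ s a → (s + s) * a ≡ 2 * (s * a)
    lem = solve-∀
  separations-bound {suc n} (false ∷ f) (true ∷ e) = begin
    separations (false ∷ f) (true ∷ e) * (2 * 2 ^ ∣ e ∣ * 2 ^ ∣ f ∣)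
      ≡⟨ cong (_* (2 * 2 ^ ∣ e ∣ * 2 ^ ∣ f ∣))
           (trans (∑-subsets-suc (λ T → ⟦ (true ∷ e) ⊆ᵇ T ⟧ * ⟦ disjointᵇ (false ∷ f) T ⟧)) (cong (s +_) (∑-zero (subsets n)))) ⟩
    (s + 0) * (2 * 2 ^ ∣ e ∣ * 2 ^ ∣ f ∣)
      ≡⟨ lem s (2 ^ ∣ e ∣) (2 ^ ∣ f ∣) ⟩
    2 * (s * (2 ^ ∣ e ∣ * 2 ^ ∣ f ∣))
      ≤⟨ *-monoʳ-≤ 2 (separations-bound f e) ⟩
    2 * 2 ^ n ∎
    where
    open ≤-Reasoning
    s = separations f e
    lem : ∀ s a b → (s + 0) * (2 * a * b) ≡ 2 * (s * (a * b))
    lem = solve-∀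
  separations-bound {suc n} (true ∷ f) (false ∷ e) = begin
    separations (true ∷ f) (false ∷ e) * (2 ^ ∣ e ∣ * (2 * 2 ^ ∣ f ∣))
      ≡⟨ cong (_* (2 ^ ∣ e ∣ * (2 * 2 ^ ∣ f ∣)))
           (trans (∑-subsets-split (λ T → *-zeroʳ ⟦ e ⊆ᵇ T ⟧) (λ _ → refl)) (cong (_+ s) (∑-zero (subsets n)))) ⟩
    s * (2 ^ ∣ e ∣ * (2 * 2 ^ ∣ f ∣))
      ≡⟨ lem s (2 ^ ∣ e ∣) (2 ^ ∣ f ∣) ⟩
    2 * (s * (2 ^ ∣ e ∣ * 2 ^ ∣ f ∣))
      ≤⟨ *-monoʳ-≤ 2 (separations-bound f e) ⟩
    2 * 2 ^ n ∎
    where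
    open ≤-Reasoning
    s = separations f e
    lem : ∀ s a b → s * (a * (2 * b)) ≡ 2 * (s * (a * b))
    lem = solve-∀
  separations-bound {suc n} (true ∷ f) (true ∷ e) =
    ≤-trans (≤-reflexive (cong (_* (2 * 2 ^ ∣ e ∣ * (2 * 2 ^ ∣ f ∣)))
      (trans (∑-subsets-split {G = λ _ → 0} {H = λ _ → 0} (λ T → *-zeroʳ ⟦ e ⊆ᵇ T ⟧) (λ _ → refl))
             (cong₂ _+_ (∑-zero (subsets n)) (∑-zero (subsets n)))))) z≤n

  completions-∉ : ∀ y (f e : Subset n) t T → completions (y ∷ f) (false ∷ e) (t ∷ T) ≡ completions f e T
  completions-∉ y f e t T = trans (∑-allFin-suc (completes (y ∷ f) (false ∷ e) (t ∷ T)))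
    (cong (_+ completions f e T) (trans (cong (λ b → ⟦ not t ⟧ * ⟦ b ⟧) (∧-zeroʳ (e ⊆ᵇ T))) (*-zeroʳ ⟦ not t ⟧)))

  -- A first vertex already in `T` cannot be the completing one. If it lies in `e` but outside `T`,
  -- as in `completions-out`, no other vertex can be.
  completions-in : ∀ y (f e T : Subset n) → completions (y ∷ f) (true ∷ e) (true ∷ T) ≡ completions f e T
  completions-in y f e T = ∑-allFin-suc (completes (y ∷ f) (true ∷ e) (true ∷ T))

  completions-out : ∀ y (f e T : Subset n) → completions (y ∷ f) (true ∷ e) (false ∷ T) ≡ ⟦ (e ⊆ᵇ T) ∧ y ⟧
  completions-out {n} y f e T = begin
    completions (y ∷ f) (true ∷ e) (false ∷ T)
      ≡⟨ ∑-allFin-suc (completes (y ∷ f) (true ∷ e) (false ∷ T)) ⟩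
    1 * ⟦ (e ⊆ᵇ T) ∧ y ⟧ + ∑ (allFin n) (λ v → ⟦ not (lookup T v) ⟧ * 0)
      ≡⟨ cong₂ _+_ (*-identityˡ ⟦ (e ⊆ᵇ T) ∧ y ⟧)
           (trans (∑-cong (allFin n) (λ v → *-zeroʳ ⟦ not (lookup T v) ⟧)) (∑-zero (allFin n))) ⟩
    ⟦ (e ⊆ᵇ T) ∧ y ⟧ + 0
      ≡⟨ +-identityʳ _ ⟩
    ⟦ (e ⊆ᵇ T) ∧ y ⟧ ∎
    where open ≡-Reasoning

  -- As `T` avoids `f`, a completing vertex must be the only common vertex of `e` and `f`. Sharing
  -- it saves one fixed coordinate, hence the factor 2 compared with `separations-bound`.
  ∑-completions : ∀ (f e : Subset n) →
    ∑ (subsets n) (λ T → completions f e T * ⟦ disjointᵇ f T ⟧) * (2 ^ ∣ e ∣ * 2 ^ ∣ f ∣) ≤ 2 * 2 ^ n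
  ∑-completions [] [] = z≤n
  ∑-completions {suc n} (false ∷ f) (false ∷ e) = begin
    ∑ (subsets (suc n)) (λ T → completions (false ∷ f) (false ∷ e) T * ⟦ disjointᵇ (false ∷ f) T ⟧) * w
      ≡⟨ cong (_* w) (∑-subsets-split (λ T → cong (_* ⟦ disjointᵇ f T ⟧) (completions-∉ false f e true T))
                                      (λ T → cong (_* ⟦ disjointᵇ f T ⟧) (completions-∉ false f e false T))) ⟩
    (s + s) * w
      ≡⟨ lem s w ⟩
    2 * (s * w)
      ≤⟨ *-monoʳ-≤ 2 (∑-completions f e) ⟩
    2 * (2 * 2 ^ n) ∎
    where
    open ≤-Reasoning
    s = ∑ (subsets n) (λ T → completions f e T * ⟦ disjointᵇ f T ⟧)
    w = 2 ^ ∣ e ∣ * 2 ^ ∣ f ∣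
    lem : ∀ s a → (s + s) * a ≡ 2 * (s * a)
    lem = solve-∀
  ∑-completions {suc n} (false ∷ f) (true ∷ e) = begin
    ∑ (subsets (suc n)) (λ T → completions (false ∷ f) (true ∷ e) T * ⟦ disjointᵇ (false ∷ f) T ⟧) * w
      ≡⟨ cong (_* w) (trans (∑-subsets-split (λ T → cong (_* ⟦ disjointᵇ f T ⟧) (completions-in false f e T))
           (λ T → cong (_* ⟦ disjointᵇ f T ⟧)
                    (trans (completions-out false f e T) (cong ⟦_⟧ (∧-zeroʳ (e ⊆ᵇ T))))))
           (cong (s +_) (∑-zero (subsets n)))) ⟩
    (s + 0) * w
      ≡⟨ lem s (2 ^ ∣ e ∣) (2 ^ ∣ f ∣) ⟩
    2 * (s * (2 ^ ∣ e ∣ * 2 ^ ∣ f ∣))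
      ≤⟨ *-monoʳ-≤ 2 (∑-completions f e) ⟩
    2 * (2 * 2 ^ n) ∎
    where
    open ≤-Reasoning
    s = ∑ (subsets n) (λ T → completions f e T * ⟦ disjointᵇ f T ⟧)
    w = 2 * 2 ^ ∣ e ∣ * 2 ^ ∣ f ∣
    lem : ∀ s a b → (s + 0) * (2 * a * b) ≡ 2 * (s * (a * b))
    lem = solve-∀
  ∑-completions {suc n} (true ∷ f) (false ∷ e) = begin
    ∑ (subsets (suc n)) (λ T → completions (true ∷ f) (false ∷ e) T * ⟦ disjointᵇ (true ∷ f) T ⟧) * w
      ≡⟨ cong (_* w) (trans (∑-subsets-split (λ T → *-zeroʳ (completions (true ∷ f) (false ∷ e) (true ∷ T)))
           (λ T → cong (_* ⟦ disjointᵇ f T ⟧) (completions-∉ true f e false T)))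
           (cong (_+ s) (∑-zero (subsets n)))) ⟩
    s * w
      ≡⟨ lem s (2 ^ ∣ e ∣) (2 ^ ∣ f ∣) ⟩
    2 * (s * (2 ^ ∣ e ∣ * 2 ^ ∣ f ∣))
      ≤⟨ *-monoʳ-≤ 2 (∑-completions f e) ⟩
    2 * (2 * 2 ^ n) ∎
    where
    open ≤-Reasoning
    s = ∑ (subsets n) (λ T → completions f e T * ⟦ disjointᵇ f T ⟧)
    w = 2 ^ ∣ e ∣ * (2 * 2 ^ ∣ f ∣)
    lem : ∀ s a b → s * (a * (2 * b)) ≡ 2 * (s * (a * b))
    lem = solve-∀
  ∑-completions {suc n} (true ∷ f) (true ∷ e) = begin
    ∑ (subsets (suc n)) (λ T → completions (true ∷ f) (true ∷ e) T * ⟦ disjointᵇ (true ∷ f) T ⟧) * w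
      ≡⟨ cong (_* w) (trans (∑-subsets-split (λ T → *-zeroʳ (completions (true ∷ f) (true ∷ e) (true ∷ T)))
           (λ T → cong (_* ⟦ disjointᵇ f T ⟧)
                    (trans (completions-out true f e T) (cong ⟦_⟧ (∧-identityʳ (e ⊆ᵇ T))))))
           (cong (_+ separations f e) (∑-zero (subsets n)))) ⟩
    separations f e * w
      ≡⟨ lem (separations f e) (2 ^ ∣ e ∣) (2 ^ ∣ f ∣) ⟩
    4 * (separations f e * (2 ^ ∣ e ∣ * 2 ^ ∣ f ∣))
      ≤⟨ *-monoʳ-≤ 4 (separations-bound f e) ⟩
    4 * 2 ^ n
      ≡⟨ lem′ (2 ^ n) ⟩
    2 * (2 * 2 ^ n) ∎
    where
    open ≤-Reasoning
    w = 2 * 2 ^ ∣ e ∣ * (2 * 2 ^ ∣ f ∣)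
    lem : ∀ s a b → s * (2 * a * (2 * b)) ≡ 4 * (s * (a * b))
    lem = solve-∀
    lem′ : ∀ a → 4 * a ≡ 2 * (2 * a)
    lem′ = solve-∀

  -- Bounding the load by a power of 4.

  bernoulli : ∀ N j → (N + j) * N ^ j ≤ N * suc N ^ j
  bernoulli N zero    = ≤-reflexive (cong (_* 1) (+-identityʳ N))
  bernoulli N (suc j) = begin
    (N + suc j) * (N * N ^ j)          ≤⟨ m≤m+n _ (j * N ^ j) ⟩
    (N + suc j) * (N * N ^ j) + j * N ^ j ≡⟨ lem N j (N ^ j) ⟩
    suc N * ((N + j) * N ^ j)          ≤⟨ *-monoʳ-≤ (suc N) (bernoulli N j) ⟩
    suc N * (N * suc N ^ j)            ≡⟨ lem′ N (suc N ^ j) ⟩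
    N * (suc N * suc N ^ j)            ∎
    where
    open ≤-Reasoning
    lem : ∀ N j p → (N + suc j) * (N * p) + j * p ≡ suc N * ((N + j) * p)
    lem = solve-∀
    lem′ : ∀ N p → suc N * (N * p) ≡ N * (suc N * p)
    lem′ = solve-∀

  -- (1 + 1/N) ^ h ≤ N / (N - h), with a = N - h.
  suc-^-bound : ∀ N a h → a + h ≤ N → a * suc N ^ h ≤ (a + h) * N ^ h
  suc-^-bound N a zero    p = ≤-reflexive (cong (_* 1) (sym (+-identityʳ a)))
  suc-^-bound N a (suc h) p = begin
    a * (suc N * suc N ^ h)     ≡⟨ lem a N (suc N ^ h) ⟩
    (a * N + a) * suc N ^ h     ≤⟨ *-monoˡ-≤ (suc N ^ h) (+-monoʳ-≤ (a * N) (≤-trans (m≤m+n a _) p)) ⟩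
    (a * N + N) * suc N ^ h     ≡⟨ lem′ a N (suc N ^ h) ⟩
    N * (suc a * suc N ^ h)     ≤⟨ *-monoʳ-≤ N (suc-^-bound N (suc a) h (≤-trans (≤-reflexive (sym (+-suc a h))) p)) ⟩
    N * ((suc a + h) * N ^ h)   ≡⟨ lem″ a N h (N ^ h) ⟩
    (a + suc h) * (N * N ^ h)   ∎
    where
    open ≤-Reasoning
    lem : ∀ a N s → a * (suc N * s) ≡ (a * N + a) * s
    lem = solve-∀
    lem′ : ∀ a N s → (a * N + N) * s ≡ N * (suc a * s)
    lem′ = solve-∀
    lem″ : ∀ a N h s → N * ((suc a + h) * s) ≡ (a + suc h) * (N * s)
    lem″ = solve-∀

  -- This is (1 + 1/N)^N ≤ 4 for even `N`: half of the exponent gives at most N / (N - h) = 2, and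
  -- the square gives 4. This is why `N` has the form `h + h`.
  suc-^≤4* : ∀ h .{{_ : NonZero h}} → suc (h + h) ^ (h + h) ≤ 4 * (h + h) ^ (h + h)
  suc-^≤4* h = begin
    suc N ^ (h + h)               ≡⟨ ^-distribˡ-+-* (suc N) h h ⟩
    suc N ^ h * suc N ^ h         ≤⟨ *-mono-≤ half half ⟩
    (2 * N ^ h) * (2 * N ^ h)     ≡⟨ lem (N ^ h) ⟩
    4 * (N ^ h * N ^ h)           ≡⟨ cong (4 *_) (sym (^-distribˡ-+-* N h h)) ⟩
    4 * N ^ (h + h)               ∎
    where
    open ≤-Reasoning
    N = h + h
    lem : ∀ a → (2 * a) * (2 * a) ≡ 4 * (a * a)
    lem = solve-∀
    lem′ : ∀ h a → (h + h) * a ≡ h * (2 * a)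
    lem′ = solve-∀
    half : suc N ^ h ≤ 2 * N ^ h
    half = *-cancelˡ-≤ h (≤-trans (suc-^-bound N h h ≤-refl) (≤-reflexive (lem′ h (N ^ h))))

  ^-distribʳ-* : ∀ k a b → (a * b) ^ k ≡ a ^ k * b ^ k
  ^-distribʳ-* zero    a b = refl
  ^-distribʳ-* (suc k) a b = trans (cong (a * b *_) (^-distribʳ-* k a b)) (lem a b (a ^ k) (b ^ k))
    where
    lem : ∀ a b c d → a * b * (c * d) ≡ (a * c) * (b * d)
    lem = solve-∀

  module LoadBound {n : ℕ} (h : ℕ) .{{_ : NonZero h}} (c : Subset n → ℕ) where

    N : ℕ
    N = h + h

    instance
      N≢0 : NonZero N
      N≢0 = >-nonZero (≤-trans (>-nonZero⁻¹ h) (m≤m+n h h))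

    open Potential N c

    weight : List (Subset n) → Subset n → ℕ
    weight es T = ∑ es (λ e → c e * near e T)

    -- Each factor 1 + j/N of the scaled load is at most (1 + 1/N)^j by `bernoulli`, so the product
    -- depends only on the total weight.
    load-weight : ∀ es T → load es T * N ^ weight es T ≤ N ^ length es * suc N ^ weight es T
    load-weight []       T = ≤-refl
    load-weight (e ∷ es) T = begin
      (N + j) * load es T * N ^ (j + w)
        ≡⟨ cong ((N + j) * load es T *_) (^-distribˡ-+-* N j w) ⟩
      (N + j) * load es T * (N ^ j * N ^ w)
        ≡⟨ lem (N + j) (load es T) (N ^ j) (N ^ w) ⟩
      ((N + j) * N ^ j) * (load es T * N ^ w)
        ≤⟨ *-mono-≤ (bernoulli N j) (load-weight es T) ⟩
      (N * suc N ^ j) * (N ^ length es * suc N ^ w)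
        ≡⟨ lem N (suc N ^ j) (N ^ length es) (suc N ^ w) ⟩
      (N * N ^ length es) * (suc N ^ j * suc N ^ w)
        ≡⟨ cong (N * N ^ length es *_) (sym (^-distribˡ-+-* (suc N) j w)) ⟩
      N ^ suc (length es) * suc N ^ (j + w) ∎
      where
      open ≤-Reasoning
      j = c e * near e T
      w = weight es T
      lem : ∀ a b c d → a * b * (c * d) ≡ (a * c) * (b * d)
      lem = solve-∀

    load-bound : ∀ M es T → weight es T ≤ N * M → load es T ≤ 4 ^ M * N ^ length es
    load-bound M es T w≤NM = *-cancelʳ-≤ _ _ (N ^ (N * M)) {{m^n≢0 N (N * M)}} (begin
      load es T * N ^ (N * M)
        ≡⟨ cong (λ x → load es T * N ^ x) (sym (m+[n∸m]≡n w≤NM)) ⟩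
      load es T * N ^ (w + d)
        ≡⟨ cong (load es T *_) (^-distribˡ-+-* N w d) ⟩
      load es T * (N ^ w * N ^ d)
        ≡⟨ sym (*-assoc (load es T) _ _) ⟩
      load es T * N ^ w * N ^ d
        -- The exponent is padded from the actual weight up to `N * M`.
        ≤⟨ *-mono-≤ (load-weight es T) (^-monoˡ-≤ d (n≤1+n N)) ⟩
      N ^ length es * suc N ^ w * suc N ^ d
        ≡⟨ *-assoc (N ^ length es) _ _ ⟩
      N ^ length es * (suc N ^ w * suc N ^ d)
        ≡⟨ cong (N ^ length es *_) (trans (sym (^-distribˡ-+-* (suc N) w d)) (cong (suc N ^_) (m+[n∸m]≡n w≤NM))) ⟩
      N ^ length es * suc N ^ (N * M)
        ≡⟨ cong (N ^ length es *_) (sym (^-*-assoc (suc N) N M)) ⟩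
      N ^ length es * (suc N ^ N) ^ M
        ≤⟨ *-monoʳ-≤ (N ^ length es) (^-monoˡ-≤ M (suc-^≤4* h)) ⟩
      N ^ length es * (4 * N ^ N) ^ M
        ≡⟨ cong (N ^ length es *_) (trans (^-distribʳ-* M 4 (N ^ N)) (cong (4 ^ M *_) (^-*-assoc N N M))) ⟩
      N ^ length es * (4 ^ M * N ^ (N * M))
        ≡⟨ lem (N ^ length es) (4 ^ M) _ ⟩
      4 ^ M * N ^ length es * N ^ (N * M) ∎)
      where
      open ≤-Reasoning
      w = weight es T
      d = N * M ∸ w
      lem : ∀ a b c → a * (b * c) ≡ b * a * c
      lem = solve-∀

  -- The logarithm, and passing from rationals to natural numbers.

  2^⌊log₂⌋≤ : ∀ ℓ k → ⌊log₂ k ⌋ ≡ ℓ → .{{NonZero k}} → 2 ^ ℓ ≤ k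
  2^⌊log₂⌋≤ zero    (suc k)       eq = s≤s z≤n
  2^⌊log₂⌋≤ (suc ℓ) (suc (suc k)) eq = begin
    2 * 2 ^ ℓ     ≤⟨ *-monoʳ-≤ 2 (2^⌊log₂⌋≤ ℓ ⌊ suc (suc k) /2⌋
                       (trans (⌊log₂⌊n/2⌋⌋≡⌊log₂n⌋∸1 (suc (suc k))) (cong (_∸ 1) eq))) ⟩
    2 * h         ≡⟨ cong (h +_) (+-identityʳ h) ⟩
    h + h         ≤⟨ +-monoʳ-≤ h (⌊n/2⌋≤⌈n/2⌉ (suc (suc k))) ⟩
    h + ⌈ suc (suc k) /2⌉ ≡⟨ ⌊n/2⌋+⌈n/2⌉≡n (suc (suc k)) ⟩
    suc (suc k)   ∎
    where
    open ≤-Reasoning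
    h = ⌊ suc (suc k) /2⌋

  -- Equals 2^n q(H) / 2, an integer since no edge exceeds `n`.
  mass : List (Subset n) → ℕ
  mass {n} E = ∑ E (λ e → 2 ^ (n ∸ ∣ e ∣))

  toℚᵘ-/ : ∀ i d .{{_ : NonZero d}} → ℚ.toℚᵘ (i ℚ./ d) ℚᵘ.≃ i ℚᵘ./ d
  toℚᵘ-/ i (suc d) = ℚ.toℚᵘ-fromℚᵘ (ℚᵘ.mkℚᵘ i d)

  +-common-denominator : ∀ w a s d .{{_ : NonZero a}} .{{_ : NonZero d}} → w * a ≡ d →
    (ℤ.+ 1 ℚᵘ./ a) ℚᵘ.+ (ℤ.+ s ℚᵘ./ d) ℚᵘ.≃ ℤ.+ (w + s) ℚᵘ./ d
  +-common-denominator w a@(suc _) s d@(suc _) eq = ℚᵘ.*≡* (begin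
    (ℤ.+ 1 ℤ.* ℤ.+ d ℤ.+ ℤ.+ s ℤ.* ℤ.+ a) ℤ.* ℤ.+ d
      ≡⟨ cong (λ x → (ℤ.+ 1 ℤ.* x ℤ.+ ℤ.+ s ℤ.* ℤ.+ a) ℤ.* ℤ.+ d) d≡ ⟩
    (ℤ.+ 1 ℤ.* (ℤ.+ w ℤ.* ℤ.+ a) ℤ.+ ℤ.+ s ℤ.* ℤ.+ a) ℤ.* ℤ.+ d
      ≡⟨ lem (ℤ.+ w) (ℤ.+ a) (ℤ.+ s) (ℤ.+ d) ⟩
    ℤ.+ (w + s) ℤ.* (ℤ.+ a ℤ.* ℤ.+ d)
      ≡⟨ cong (ℤ.+ (w + s) ℤ.*_) (sym (ℤ.pos-* a d)) ⟩
    ℤ.+ (w + s) ℤ.* ℤ.+ (a * d) ∎)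
    where
    open ≡-Reasoning
    d≡ : ℤ.+ d ≡ ℤ.+ w ℤ.* ℤ.+ a
    d≡ = trans (cong ℤ.+_ (sym eq)) (ℤ.pos-* w a)
    lem : ∀ w a s d → (ℤ.+ 1 ℤ.* (w ℤ.* a) ℤ.+ s ℤ.* a) ℤ.* d ≡ (w ℤ.+ s) ℤ.* (a ℤ.* d)
    lem = ℤ-solve-∀

  -- Over unnormalised rationals every weight can be brought to the denominator `2 ^ n` with no
  -- reduction. The size hypothesis makes `∣ e ∣ ∸ 1` a genuine subtraction.
  toℚᵘ-q : ∀ (E : List (Subset n)) → All (λ e → 2 ≤ ∣ e ∣) E →
    ℚ.toℚᵘ (q E) ℚᵘ.≃ (ℤ.+ (2 * mass E) ℚᵘ./ 2 ^ n) {{m^n≢0 2 n}}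
  toℚᵘ-q {n} []      []       = zero/ (2 ^ n) {{m^n≢0 2 n}}
    where
    zero/ : ∀ d .{{_ : NonZero d}} → ℚ.toℚᵘ ℚ.0ℚ ℚᵘ.≃ (ℤ.+ 0 ℚᵘ./ d)
    zero/ (suc d) = ℚᵘ.*≡* refl
  toℚᵘ-q {n} (e ∷ E) (p ∷ ps) = begin
    ℚ.toℚᵘ (edgeWeight e ℚ.+ q E)
      ≈⟨ ℚ.toℚᵘ-homo-+ (edgeWeight e) (q E) ⟩
    ℚ.toℚᵘ (edgeWeight e) ℚᵘ.+ ℚ.toℚᵘ (q E)
      ≈⟨ ℚᵘ.+-cong (toℚᵘ-/ (ℤ.+ 1) (2 ^ (∣ e ∣ ∸ 1)) {{m^n≢0 2 (∣ e ∣ ∸ 1)}}) (toℚᵘ-q E ps) ⟩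
    (ℤ.+ 1 ℚᵘ./ 2 ^ (∣ e ∣ ∸ 1)) {{m^n≢0 2 (∣ e ∣ ∸ 1)}} ℚᵘ.+ (ℤ.+ (2 * mass E) ℚᵘ./ 2 ^ n) {{m^n≢0 2 n}}
      ≈⟨ +-common-denominator (2 * 2 ^ (n ∸ ∣ e ∣)) (2 ^ (∣ e ∣ ∸ 1)) (2 * mass E) (2 ^ n)
           {{m^n≢0 2 (∣ e ∣ ∸ 1)}} {{m^n≢0 2 n}} (powers ∣ e ∣ p (∣p∣≤n e)) ⟩
    (ℤ.+ (2 * 2 ^ (n ∸ ∣ e ∣) + 2 * mass E) ℚᵘ./ 2 ^ n) {{m^n≢0 2 n}}
      ≡⟨ cong (λ x → (ℤ.+ x ℚᵘ./ 2 ^ n) {{m^n≢0 2 n}}) (sym (*-distribˡ-+ 2 (2 ^ (n ∸ ∣ e ∣)) (mass E))) ⟩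
    (ℤ.+ (2 * mass (e ∷ E)) ℚᵘ./ 2 ^ n) {{m^n≢0 2 n}} ∎
    where
    open import Relation.Binary.Reasoning.Setoid ℚᵘ.≃-setoid
    powers : ∀ m → 2 ≤ m → m ≤ n → 2 * 2 ^ (n ∸ m) * 2 ^ (m ∸ 1) ≡ 2 ^ n
    powers m@(suc m-1) _ m≤n = trans (lem (2 ^ (n ∸ m)) (2 ^ m-1))
      (trans (sym (^-distribˡ-+-* 2 (n ∸ m) m)) (cong (2 ^_) (m∸n+n≡m m≤n)))
      where
      lem : ∀ a b → 2 * a * b ≡ a * (2 * b)
      lem = solve-∀

  q≤⇒mass≤ : ∀ (E : List (Subset n)) ℓ → All (λ e → 2 ≤ ∣ e ∣) E →
    q E ℚ.≤ (ℤ.+ 1 ℚ./ 32) ℚ.* (ℤ.+ ℓ ℚ./ 1) → 64 * mass E ≤ ℓ * 2 ^ n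
  q≤⇒mass≤ {n} E ℓ sizes q≤ = extract (mass E) ℓ (2 ^ n) {{m^n≢0 2 n}} (begin
    (ℤ.+ (2 * mass E) ℚᵘ./ 2 ^ n) {{m^n≢0 2 n}}           ≃⟨ ℚᵘ.≃-sym (toℚᵘ-q E sizes) ⟩
    ℚ.toℚᵘ (q E)                                          ≤⟨ ℚ.toℚᵘ-mono-≤ q≤ ⟩
    ℚ.toℚᵘ ((ℤ.+ 1 ℚ./ 32) ℚ.* (ℤ.+ ℓ ℚ./ 1))             ≃⟨ ℚ.toℚᵘ-homo-* (ℤ.+ 1 ℚ./ 32) (ℤ.+ ℓ ℚ./ 1) ⟩
    ℚ.toℚᵘ (ℤ.+ 1 ℚ./ 32) ℚᵘ.* ℚ.toℚᵘ (ℤ.+ ℓ ℚ./ 1)       ≃⟨ ℚᵘ.*-cong (toℚᵘ-/ (ℤ.+ 1) 32) (toℚᵘ-/ (ℤ.+ ℓ) 1) ⟩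
    (ℤ.+ 1 ℚᵘ./ 32) ℚᵘ.* (ℤ.+ ℓ ℚᵘ./ 1)                   ∎)
    where
    open ℚᵘ.≤-Reasoning
    extract : ∀ s ℓ d .{{_ : NonZero d}} →
      (ℤ.+ (2 * s) ℚᵘ./ d) ℚᵘ.≤ (ℤ.+ 1 ℚᵘ./ 32) ℚᵘ.* (ℤ.+ ℓ ℚᵘ./ 1) → 64 * s ≤ ℓ * d
    extract s ℓ d@(suc _) (ℚᵘ.*≤* p) = ≤-trans (≤-reflexive (lem s)) (ℤ.drop‿+≤+
      (subst₂ ℤ._≤_ (sym (ℤ.pos-* (2 * s) 32))
         (trans (cong (ℤ._* ℤ.+ d) (ℤ.*-identityˡ (ℤ.+ ℓ))) (sym (ℤ.pos-* ℓ d))) p))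
      where
      lem : ∀ s → 64 * s ≡ 2 * s * 32
      lem = solve-∀

  -- Combining the repairs of both color classes.

  disjointᵇ-false : ∀ (f T : Subset n) → disjointᵇ f T ≡ false → ∃ λ v → lookup f v ≡ true × lookup T v ≡ true
  disjointᵇ-false []          []          ()
  disjointᵇ-false (true  ∷ f) (true  ∷ T) p = zero , refl , refl
  disjointᵇ-false (true  ∷ f) (false ∷ T) p = let v , q = disjointᵇ-false f T p in suc v , q
  disjointᵇ-false (false ∷ f) (_     ∷ T) p = let v , q = disjointᵇ-false f T p in suc v , q

  disjointᵇ-true : ∀ (f T : Subset n) → disjointᵇ f T ≡ true → ∀ v → lookup f v ≡ true → lookup T v ≡ false
  disjointᵇ-true (true  ∷ f) (false ∷ T) p zero    q = refl
  disjointᵇ-true (true  ∷ f) (false ∷ T) p (suc v) q = disjointᵇ-true f T p v q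
  disjointᵇ-true (false ∷ f) (_     ∷ T) p (suc v) q = disjointᵇ-true f T p v q

  ⋠⇒∃ : ∀ (e T : Subset n) → ¬ (e ≼ T) → ∃ λ v → lookup e v ≡ true × lookup T v ≡ false
  ⋠⇒∃ []          []          h = contradiction (λ ()) h
  ⋠⇒∃ (true  ∷ e) (false ∷ T) h = zero , refl , refl
  ⋠⇒∃ (true  ∷ e) (true  ∷ T) h =
    let v , q = ⋠⇒∃ e T (λ e≼T → h λ { zero _ → refl ; (suc v) → e≼T v }) in suc v , q
  ⋠⇒∃ (false ∷ e) (t     ∷ T) h =
    let v , q = ⋠⇒∃ e T (λ e≼T → h λ { (suc v) → e≼T v }) in suc v , q

  ∑<1⇒All : ∀ (xs : List A) {f : A → ℕ} → ∑ xs f < 1 → All (λ x → f x ≡ 0) xs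
  ∑<1⇒All []           lt = []
  ∑<1⇒All (x ∷ xs) {f} lt =
    n<1⇒n≡0 (≤-<-trans (m≤m+n (f x) _) lt) ∷ ∑<1⇒All xs (≤-<-trans (m≤n+m _ (f x)) lt)

  meets : Subset n → Subset n → ℕ
  meets f σ = ⟦ not (disjointᵇ f σ) ⟧

  record Repair {n} (E : List (Subset n)) (σ : Subset n) : Set where
    field
      kept     : Subset n
      kept≼    : kept ≼ σ
      breaks   : All (λ e → ¬ (e ≼ kept)) E
      survives : All (λ f → disjointᵇ f σ ≡ false → disjointᵇ f kept ≡ false) E

  -- Red are the kept vertices of `σ` and the switched vertices of `∁ σ`. An edge meeting `σ` has a
  -- red vertex by `survives` for `σ`; an edge inside `∁ σ` gets one by `breaks` for `∁ σ`. Blue is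
  -- symmetric.
  combine : ∀ (E : List (Subset n)) σ → Repair E σ → Repair E (∁ σ) → TwoColorable E
  combine {n} E σ R B = color , All.zipWith (λ {e} → proper e) (All.zip (R.breaks , R.survives) , All.zip (B.breaks , B.survives))
    where
    module R = Repair R
    module B = Repair B
    color : Coloring n
    color v = lookup R.kept v ∨ (not (lookup σ v) ∧ not (lookup B.kept v))

    ∁-true : ∀ {v} → lookup (∁ σ) v ≡ true → lookup σ v ≡ false
    ∁-true {v} p with lookup σ v | trans (sym (lookup-map v not σ)) p
    ... | false | _ = refl

    ∁-false : ∀ {v} → lookup (∁ σ) v ≡ false → lookup σ v ≡ true
    ∁-false {v} p with lookup σ v | trans (sym (lookup-map v not σ)) p
    ... | true | _ = refl

    red-kept : ∀ {v} → lookup R.kept v ≡ true → color v ≡ true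
    red-kept p rewrite p = refl

    red-switched : ∀ {v} → lookup σ v ≡ false → lookup B.kept v ≡ false → color v ≡ true
    red-switched {v} p q rewrite p | q with lookup R.kept v
    ... | true  = refl
    ... | false = refl

    not-kept : ∀ {v} → lookup σ v ≡ false → lookup R.kept v ≡ false
    not-kept {v} p with lookup R.kept v in eq
    ... | false = refl
    ... | true  = contradiction (trans (sym p) (R.kept≼ v eq)) λ ()

    blue-kept : ∀ {v} → lookup B.kept v ≡ true → color v ≡ false
    blue-kept {v} p rewrite not-kept (∁-true (B.kept≼ v p)) | ∁-true (B.kept≼ v p) | p = refl

    blue-switched : ∀ {v} → lookup σ v ≡ true → lookup R.kept v ≡ false → color v ≡ false
    blue-switched p q rewrite p | q = refl

    hasRed : ∀ e → ¬ (e ≼ B.kept) → (disjointᵇ e σ ≡ false → disjointᵇ e R.kept ≡ false) →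
             ∃ λ v → lookup e v ≡ true × color v ≡ true
    hasRed e br su with disjointᵇ e σ in eq
    ... | false = let v , p , r = disjointᵇ-false e R.kept (su refl) in v , p , red-kept r
    ... | true  = let v , p , r = ⋠⇒∃ e B.kept br in v , p , red-switched (disjointᵇ-true e σ eq v p) r

    hasBlue : ∀ e → ¬ (e ≼ R.kept) → (disjointᵇ e (∁ σ) ≡ false → disjointᵇ e B.kept ≡ false) →
              ∃ λ v → lookup e v ≡ true × color v ≡ false
    hasBlue e br su with disjointᵇ e (∁ σ) in eq
    ... | false = let v , p , r = disjointᵇ-false e B.kept (su refl) in v , p , blue-kept r
    ... | true  = let v , p , r = ⋠⇒∃ e R.kept br
                  in  v , p , blue-switched (∁-false (disjointᵇ-true e (∁ σ) eq v p)) r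

    proper : ∀ e →
      (¬ (e ≼ R.kept) × (disjointᵇ e σ ≡ false → disjointᵇ e R.kept ≡ false)) ×
      (¬ (e ≼ B.kept) × (disjointᵇ e (∁ σ) ≡ false → disjointᵇ e B.kept ≡ false)) →
      (∃ λ v → v ∈ e × color v ≡ true) × (∃ λ v → v ∈ e × color v ≡ false)
    proper e ((br , sr) , (bb , sb)) =
      let v , p , r = hasRed e bb sr
          w , s , t = hasBlue e br sb
      in  (v , lookup⇒[]= v e p , r) , (w , lookup⇒[]= w e s , t)

  -- Averaging over the initial coloring.

  module Averaging {n : ℕ} (h : ℕ) .{{_ : NonZero h}} (c : Subset n → ℕ)
                   (E : List (Subset n)) (k M : ℕ) .{{_ : NonZero k}} .{{_ : NonZero M}}
                   (normal : All (λ e → c e * ∣ e ∣ ≡ h + h) E) (large : All (λ e → k ≤ ∣ e ∣) E)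
                   (mass≤ : 8 * mass E ≤ M * 2 ^ n) (k-large : 4 ^ M * (M * M) ≤ k) where
    open LoadBound h c
    open Potential N c
    open Process N c
    open ≤-Reasoning

    W : ℕ
    W = N ^ length E

    lightᵇ : Subset n → Bool
    lightᵇ σ = weight E σ ≤ᵇ N * M

    -- A heavy `σ` is charged the full `W`, so `cost σ < W` gives lightness and small risk at once,
    -- and a single average over `σ` suffices.
    heavy light risk cost : Subset n → ℕ
    heavy σ = ⟦ not (lightᵇ σ) ⟧
    light σ = ⟦ lightᵇ σ ⟧
    risk σ  = ∑ E (λ f → meets f σ * pot f E σ)
    cost σ  = heavy σ * W + light σ * risk σ

    heavy≤weight : ∀ σ → N * M * heavy σ ≤ weight E σ
    heavy≤weight σ with lightᵇ σ in eq
    ... | true  = ≤-trans (≤-reflexive (*-zeroʳ (N * M))) z≤n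
    ... | false = ≤-trans (≤-reflexive (*-identityʳ (N * M)))
                          (<⇒≤ (≰⇒> (λ w≤ → subst T eq (≤⇒≤ᵇ w≤))))

    2^[n∸∣e∣]* : ∀ (e : Subset n) → 2 ^ (n ∸ ∣ e ∣) * 2 ^ ∣ e ∣ ≡ 2 ^ n
    2^[n∸∣e∣]* e = trans (sym (^-distribˡ-+-* 2 (n ∸ ∣ e ∣) ∣ e ∣)) (cong (2 ^_) (m∸n+n≡m (∣p∣≤n e)))

    c*∑near : ∀ e → c e * ∣ e ∣ ≡ N → c e * ∑ P (near e) ≤ N * (2 * 2 ^ (n ∸ ∣ e ∣))
    c*∑near e cN = *-cancelʳ-≤ _ _ (2 ^ ∣ e ∣) {{m^n≢0 2 ∣ e ∣}} (≤-reflexive (begin-equality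
      c e * ∑ P (near e) * 2 ^ ∣ e ∣
        ≡⟨ *-assoc (c e) _ _ ⟩
      c e * (∑ P (near e) * 2 ^ ∣ e ∣)
        ≡⟨ cong (c e *_) (∑-near e) ⟩
      c e * (∣ e ∣ * (2 * 2 ^ n))
        ≡⟨ sym (*-assoc (c e) _ _) ⟩
      c e * ∣ e ∣ * (2 * 2 ^ n)
        ≡⟨ cong₂ (λ x y → x * (2 * y)) cN (sym (2^[n∸∣e∣]* e)) ⟩
      N * (2 * (2 ^ (n ∸ ∣ e ∣) * 2 ^ ∣ e ∣))
        ≡⟨ lem N (2 ^ (n ∸ ∣ e ∣)) _ ⟩
      N * (2 * 2 ^ (n ∸ ∣ e ∣)) * 2 ^ ∣ e ∣ ∎))
      where
      lem : ∀ N a b → N * (2 * (a * b)) ≡ N * (2 * a) * b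
      lem = solve-∀

    -- Markov's inequality for `weight E`, whose mean is at most N q(H).
    ∑-heavy : M * ∑ P heavy ≤ 2 * mass E
    ∑-heavy = *-cancelˡ-≤ N (begin
      N * (M * ∑ P heavy)
        ≡⟨ sym (*-assoc N M _) ⟩
      N * M * ∑ P heavy
        ≡⟨ *-∑ P (N * M) heavy ⟩
      ∑ P (λ σ → N * M * heavy σ)
        ≤⟨ ∑-mono P heavy≤weight ⟩
      ∑ P (weight E)
        ≡⟨ ∑-swap P E _ ⟩
      ∑ E (λ e → ∑ P (λ σ → c e * near e σ))
        ≡⟨ ∑-cong E (λ e → sym (*-∑ P (c e) (near e))) ⟩
      ∑ E (λ e → c e * ∑ P (near e))
        ≤⟨ ∑-mono-All (All.map (λ {e} → c*∑near e) normal) ⟩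
      ∑ E (λ e → N * (2 * 2 ^ (n ∸ ∣ e ∣)))
        ≡⟨ sym (*-∑ E N _) ⟩
      N * ∑ E (λ e → 2 * 2 ^ (n ∸ ∣ e ∣))
        ≡⟨ cong (N *_) (sym (*-∑ E 2 _)) ⟩
      N * (2 * mass E) ∎)

    initial : Subset n → Subset n → ℕ
    initial f σ = light σ * meets f σ

    K : ℕ
    K = 4 ^ M * W

    -- Heavy sets have initial weight 0; for light ones `load-bound` applies.
    initial-load : ∀ f T → initial f T * load E T ≤ K
    initial-load f σ with lightᵇ σ in eq
    ... | false = z≤n
    ... | true  = begin
      1 * meets f σ * load E σ   ≤⟨ *-monoˡ-≤ (load E σ) (*-monoʳ-≤ 1 (⟦⟧≤1 (not (disjointᵇ f σ)))) ⟩
      1 * load E σ               ≡⟨ *-identityˡ _ ⟩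
      load E σ                   ≤⟨ load-bound M E σ (≤ᵇ⇒≤ _ _ (subst T (sym eq) tt)) ⟩
      K                          ∎

    blocked : Subset n → Subset n → ℕ
    blocked f e = ∑ P (λ T → completions f e T * ⟦ disjointᵇ f T ⟧)

    -- Kills the empty chain in `pull-bound`: an `f` that met the initial red set needs at least one
    -- switch to lose it.
    initial-disjoint : ∀ f T → initial f T * ⟦ disjointᵇ f T ⟧ ≡ 0
    initial-disjoint f T with disjointᵇ f T
    ... | true  = cong (_* 1) (*-zeroʳ (light T))
    ... | false = *-zeroʳ (light T * 1)

    ∑-initial-pot : ∀ f → N * ∑ P (λ σ → initial f σ * pot f E σ) ≤ K * ∑ E (λ e → c e * blocked f e)
    ∑-initial-pot f = begin
      N * ∑ P (λ σ → initial f σ * pot f E σ)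
        ≡⟨ cong (N *_) (pull-adjoint f E (initial f)) ⟩
      N * ∑ P (λ T → pull f (initial f) E T * d T)
        ≡⟨ trans (*-∑ P N _) (∑-cong P (λ T → sym (*-assoc N _ _))) ⟩
      ∑ P (λ T → N * pull f (initial f) E T * d T)
        ≤⟨ ∑-mono P (λ T → *-monoˡ-≤ (d T) (pull-bound f E (initial f) (initial-load f) T)) ⟩
      ∑ P (λ T → (N ^ suc (length E) * initial f T + K * ∑ E (λ e → c e * completions f e T)) * d T)
        ≡⟨ ∑-cong P drop-initial ⟩
      ∑ P (λ T → K * ∑ E (λ e → c e * (completions f e T * d T)))
        ≡⟨ sym (*-∑ P K _) ⟩
      K * ∑ P (λ T → ∑ E (λ e → c e * (completions f e T * d T)))
        ≡⟨ cong (K *_) (trans (∑-swap P E _) (∑-cong E (λ e → sym (*-∑ P (c e) _)))) ⟩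
      K * ∑ E (λ e → c e * blocked f e) ∎
      where
      d : Subset n → ℕ
      d T = ⟦ disjointᵇ f T ⟧
      lem : ∀ a s K r d → (a * s + K * r) * d ≡ a * (s * d) + K * (r * d)
      lem = solve-∀
      drop-initial : ∀ T → (N ^ suc (length E) * initial f T + K * ∑ E (λ e → c e * completions f e T)) * d T ≡
                         K * ∑ E (λ e → c e * (completions f e T * d T))
      drop-initial T = begin-equality
        (N ^ suc (length E) * initial f T + K * ∑ E (λ e → c e * completions f e T)) * d T
          ≡⟨ lem (N ^ suc (length E)) (initial f T) K _ (d T) ⟩
        N ^ suc (length E) * (initial f T * d T) + K * (∑ E (λ e → c e * completions f e T) * d T)
          ≡⟨ cong₂ (λ x y → N ^ suc (length E) * x + K * y) (initial-disjoint f T)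
               (trans (∑-* E _ (d T)) (∑-cong E (λ e → *-assoc (c e) _ _))) ⟩
        N ^ suc (length E) * 0 + K * ∑ E (λ e → c e * (completions f e T * d T))
          ≡⟨ cong (_+ K * ∑ E (λ e → c e * (completions f e T * d T))) (*-zeroʳ (N ^ suc (length E))) ⟩
        K * ∑ E (λ e → c e * (completions f e T * d T)) ∎

    -- In this product form the double sum over edges factors into `mass E * mass E`.
    blocked-bound : ∀ f e → 2 ^ n * blocked f e ≤ 2 * (2 ^ (n ∸ ∣ f ∣) * 2 ^ (n ∸ ∣ e ∣))
    blocked-bound f e = *-cancelʳ-≤ _ _ (2 ^ ∣ e ∣ * 2 ^ ∣ f ∣)
      {{m*n≢0 (2 ^ ∣ e ∣) (2 ^ ∣ f ∣) {{m^n≢0 2 ∣ e ∣}} {{m^n≢0 2 ∣ f ∣}}}} (begin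
      2 ^ n * blocked f e * (2 ^ ∣ e ∣ * 2 ^ ∣ f ∣)
        ≡⟨ *-assoc (2 ^ n) _ _ ⟩
      2 ^ n * (blocked f e * (2 ^ ∣ e ∣ * 2 ^ ∣ f ∣))
        ≤⟨ *-monoʳ-≤ (2 ^ n) (∑-completions f e) ⟩
      2 ^ n * (2 * 2 ^ n)
        ≡⟨ cong₂ (λ x y → x * (2 * y)) (sym (2^[n∸∣e∣]* f)) (sym (2^[n∸∣e∣]* e)) ⟩
      2 ^ (n ∸ ∣ f ∣) * 2 ^ ∣ f ∣ * (2 * (2 ^ (n ∸ ∣ e ∣) * 2 ^ ∣ e ∣))
        ≡⟨ lem (2 ^ (n ∸ ∣ f ∣)) (2 ^ ∣ f ∣) (2 ^ (n ∸ ∣ e ∣)) (2 ^ ∣ e ∣) ⟩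
      2 * (2 ^ (n ∸ ∣ f ∣) * 2 ^ (n ∸ ∣ e ∣)) * (2 ^ ∣ e ∣ * 2 ^ ∣ f ∣) ∎)
      where
      lem : ∀ a b c d → a * b * (2 * (c * d)) ≡ 2 * (a * c) * (d * b)
      lem = solve-∀

    X : ℕ
    X = ∑ P (λ σ → light σ * risk σ)

    X-unfold : X ≡ ∑ E (λ f → ∑ P (λ σ → initial f σ * pot f E σ))
    X-unfold = trans (∑-cong P (λ σ → trans (*-∑ E (light σ) _) (∑-cong E (λ f → sym (*-assoc (light σ) _ _)))))
                     (∑-swap P E _)

    k*c≤N : All (λ e → k * c e ≤ N) E
    k*c≤N = All.zipWith (λ {e} (k≤ , cN) → ≤-trans (*-monoˡ-≤ (c e) k≤)
              (≤-reflexive (trans (*-comm ∣ e ∣ (c e)) cN))) (large , normal)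

    -- The gain of `k` comes from the separated link: its weight `c e` is at most N / k because
    -- edges have at least `k` vertices.
    k*X≤ : k * X ≤ K * ∑ E (λ f → ∑ E (blocked f))
    k*X≤ = *-cancelˡ-≤ N (begin
      N * (k * X)
        ≡⟨ lem N k X ⟩
      k * (N * X)
        ≡⟨ cong (λ x → k * (N * x)) X-unfold ⟩
      k * (N * ∑ E (λ f → ∑ P (λ σ → initial f σ * pot f E σ)))
        ≡⟨ cong (k *_) (*-∑ E N _) ⟩
      k * ∑ E (λ f → N * ∑ P (λ σ → initial f σ * pot f E σ))
        ≤⟨ *-monoʳ-≤ k (∑-mono E ∑-initial-pot) ⟩
      k * ∑ E (λ f → K * ∑ E (λ e → c e * blocked f e))
        ≡⟨ cong (k *_) (sym (*-∑ E K _)) ⟩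
      k * (K * ∑ E (λ f → ∑ E (λ e → c e * blocked f e)))
        ≡⟨ lem k K _ ⟩
      K * (k * ∑ E (λ f → ∑ E (λ e → c e * blocked f e)))
        ≡⟨ cong (K *_) (trans (*-∑ E k _) (∑-cong E (λ f → trans (*-∑ E k _)
             (∑-cong E (λ e → sym (*-assoc k (c e) _)))))) ⟩
      K * ∑ E (λ f → ∑ E (λ e → k * c e * blocked f e))
        ≤⟨ *-monoʳ-≤ K (∑-mono E (λ f → ∑-mono-All (All.map (λ {e} → *-monoˡ-≤ (blocked f e)) k*c≤N))) ⟩
      K * ∑ E (λ f → ∑ E (λ e → N * blocked f e))
        ≡⟨ cong (K *_) (trans (∑-cong E (λ f → sym (*-∑ E N _))) (sym (*-∑ E N _))) ⟩
      K * (N * ∑ E (λ f → ∑ E (blocked f)))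
        ≡⟨ lem K N _ ⟩
      N * (K * ∑ E (λ f → ∑ E (blocked f))) ∎)
      where
      lem : ∀ a b c → a * (b * c) ≡ b * (a * c)
      lem = solve-∀

    ∑∑-blocked : 2 ^ n * ∑ E (λ f → ∑ E (blocked f)) ≤ 2 * (mass E * mass E)
    ∑∑-blocked = begin
      2 ^ n * ∑ E (λ f → ∑ E (blocked f))
        ≡⟨ trans (*-∑ E (2 ^ n) _) (∑-cong E (λ f → *-∑ E (2 ^ n) _)) ⟩
      ∑ E (λ f → ∑ E (λ e → 2 ^ n * blocked f e))
        ≤⟨ ∑-mono E (λ f → ∑-mono E (blocked-bound f)) ⟩
      ∑ E (λ f → ∑ E (λ e → 2 * (2 ^ (n ∸ ∣ f ∣) * 2 ^ (n ∸ ∣ e ∣))))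
        ≡⟨ ∑-cong E (λ f → trans (sym (*-∑ E 2 _)) (cong (2 *_) (sym (*-∑ E (2 ^ (n ∸ ∣ f ∣)) _)))) ⟩
      ∑ E (λ f → 2 * (2 ^ (n ∸ ∣ f ∣) * mass E))
        ≡⟨ trans (sym (*-∑ E 2 _)) (cong (2 *_) (sym (∑-* E _ (mass E)))) ⟩
      2 * (mass E * mass E) ∎

    32*X≤ : 32 * X ≤ 2 ^ n * W
    32*X≤ = *-cancelˡ-≤ (2 * (2 ^ n * k)) {{m*n≢0 2 (2 ^ n * k) {{_}} {{m*n≢0 (2 ^ n) k {{m^n≢0 2 n}}}}}} (begin
      -- The scaling makes 64 = 8 * 8 available, one 8 for each use of `mass≤`; `k-large` then
      -- absorbs `4 ^ M * (M * M)`.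
      2 * (B * k) * (32 * X)
        ≡⟨ lem₁ B k X ⟩
      64 * (B * (k * X))
        ≤⟨ *-monoʳ-≤ 64 (*-monoʳ-≤ B k*X≤) ⟩
      64 * (B * (K * Y))
        ≡⟨ lem₂ B K Y ⟩
      64 * (K * (B * Y))
        ≤⟨ *-monoʳ-≤ 64 (*-monoʳ-≤ K ∑∑-blocked) ⟩
      64 * (K * (2 * (mass E * mass E)))
        ≡⟨ lem₃ K (mass E) ⟩
      2 * K * ((8 * mass E) * (8 * mass E))
        ≤⟨ *-monoʳ-≤ (2 * K) (*-mono-≤ mass≤ mass≤) ⟩
      2 * (4 ^ M * W) * ((M * B) * (M * B))
        ≡⟨ lem₄ (4 ^ M) W M B ⟩
      2 * (B * (4 ^ M * (M * M))) * (B * W)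
        ≤⟨ *-monoˡ-≤ (B * W) (*-monoʳ-≤ 2 (*-monoʳ-≤ B k-large)) ⟩
      2 * (B * k) * (B * W) ∎)
      where
      B = 2 ^ n
      Y = ∑ E (λ f → ∑ E (blocked f))
      lem₁ : ∀ B k X → 2 * (B * k) * (32 * X) ≡ 64 * (B * (k * X))
      lem₁ = solve-∀
      lem₂ : ∀ B K Y → 64 * (B * (K * Y)) ≡ 64 * (K * (B * Y))
      lem₂ = solve-∀
      lem₃ : ∀ K s → 64 * (K * (2 * (s * s))) ≡ 2 * K * ((8 * s) * (8 * s))
      lem₃ = solve-∀
      lem₄ : ∀ F W M B → 2 * (F * W) * ((M * B) * (M * B)) ≡ 2 * (B * (F * (M * M))) * (B * W)
      lem₄ = solve-∀

    -- `mass≤` says that q(H) is at most M / 4, so at most a quarter of all sets are heavy.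
    4*heavy≤ : 4 * ∑ P heavy ≤ 2 ^ n
    4*heavy≤ = *-cancelˡ-≤ M (begin
      M * (4 * ∑ P heavy)   ≡⟨ lem M _ ⟩
      4 * (M * ∑ P heavy)   ≤⟨ *-monoʳ-≤ 4 ∑-heavy ⟩
      4 * (2 * mass E)      ≡⟨ sym (*-assoc 4 2 (mass E)) ⟩
      8 * mass E            ≤⟨ mass≤ ⟩
      M * 2 ^ n             ∎)
      where
      lem : ∀ M x → M * (4 * x) ≡ 4 * (M * x)
      lem = solve-∀

    ∑-cost : 32 * ∑ P cost ≤ 9 * (2 ^ n * W)
    ∑-cost = begin
      32 * ∑ P cost
        ≡⟨ cong (32 *_) (trans (∑-+ P _ _) (cong (_+ X) (sym (∑-* P heavy W)))) ⟩
      32 * (∑ P heavy * W + X)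
        ≡⟨ lem₁ (∑ P heavy) W X ⟩
      8 * (4 * ∑ P heavy * W) + 32 * X
        ≤⟨ +-mono-≤ (*-monoʳ-≤ 8 (*-monoˡ-≤ W 4*heavy≤)) 32*X≤ ⟩
      8 * (2 ^ n * W) + 2 ^ n * W
        ≡⟨ lem₂ (2 ^ n * W) ⟩
      9 * (2 ^ n * W) ∎
      where
      lem₁ : ∀ a W X → 32 * (a * W + X) ≡ 8 * (4 * a * W) + 32 * X
      lem₁ = solve-∀
      lem₂ : ∀ a → 8 * a + a ≡ 9 * a
      lem₂ = solve-∀

    ∑-cost-both : ∑ P (λ σ → cost σ + cost (∁ σ)) < ∑ P (λ _ → W)
    ∑-cost-both = *-cancelˡ-< 32 _ _ (begin-strict
      32 * ∑ P (λ σ → cost σ + cost (∁ σ))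
        ≡⟨ cong (32 *_) (trans (∑-+ P cost (λ σ → cost (∁ σ))) (cong (∑ P cost +_) (∑-subsets-∁ cost))) ⟩
      32 * (∑ P cost + ∑ P cost)
        ≡⟨ *-distribˡ-+ 32 (∑ P cost) _ ⟩
      32 * ∑ P cost + 32 * ∑ P cost
        ≤⟨ +-mono-≤ ∑-cost ∑-cost ⟩
      9 * (2 ^ n * W) + 9 * (2 ^ n * W)
        ≡⟨ sym (*-distribʳ-+ (2 ^ n * W) 9 9) ⟩
      18 * (2 ^ n * W)
        -- Each color class has mean cost at most (8 + 1)/32 of `W`, both together 18/32;
        -- `m≤m+n 19 13` is 18 < 32.
        <⟨ *-monoˡ-< (2 ^ n * W) {{m*n≢0 (2 ^ n) W {{m^n≢0 2 n}} {{m^n≢0 N (length E)}}}} (m≤m+n 19 13) ⟩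
      32 * (2 ^ n * W)
        ≡⟨ cong (32 *_) (sym (∑-subsets-const n W)) ⟩
      32 * ∑ P (λ _ → W) ∎)

    cheap⇒Repair : ∀ σ → cost σ < W → Repair E σ
    cheap⇒Repair σ lt = record
      { kept     = proj₁ found
      ; kept≼    = proj₁ (proj₂ found)
      ; breaks   = proj₁ (proj₂ (proj₂ found))
      ; survives = All.map (λ {f} → decode f) (∑<1⇒All E (proj₂ (proj₂ (proj₂ found))))
      }
      where
      risk<W : risk σ < W
      risk<W with lightᵇ σ
      ... | true  = ≤-<-trans (≤-reflexive (sym (*-identityˡ (risk σ)))) lt
      ... | false = contradiction (≤-<-trans (≤-trans (≤-reflexive (sym (*-identityˡ W))) (m≤m+n (1 * W) _)) lt) (<-irrefl refl)
      found = greedy (λ f → meets f σ) E E σ normal risk<W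
      decode : ∀ f → meets f σ * ⟦ disjointᵇ f (proj₁ found) ⟧ ≡ 0 →
               disjointᵇ f σ ≡ false → disjointᵇ f (proj₁ found) ≡ false
      decode f p q rewrite q with disjointᵇ f (proj₁ found)
      ... | false = refl

    colorable : TwoColorable E
    colorable =
      let σ , lt = ∑-<⇒∃ P ∑-cost-both
      in  combine E σ (cheap⇒Repair σ (≤-<-trans (m≤m+n _ _) lt))
                      (cheap⇒Repair (∁ σ) (≤-<-trans (m≤n+m _ (cost σ)) lt))

  -- Choice of the parameters.

  share : ℕ → ℕ → ℕ
  share N zero    = 0
  share N (suc a) = N / suc a

  -- Every edge size from 2 to `n` divides `n !`; doubling it provides the even `N` needed for the
  -- bound by 4.
  share-* : ∀ n a → 2 ≤ a → a ≤ n → share (n ! + n !) a * a ≡ n ! + n !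
  share-* n (suc a) _ a≤n = m/n*n≡m (∣m∣n⇒∣m+n a∣n! a∣n!)
    where
    a∣n! : suc a ∣ n !
    a∣n! = ∣-trans (m∣m*n (a !)) (m≤n⇒m!∣n! a≤n)

  n≤2^n : ∀ m → m ≤ 2 ^ m
  n≤2^n m = <⇒≤ (n<2^n m)
    where
    n<2^n : ∀ m → m < 2 ^ m
    n<2^n zero    = s≤s z≤n
    n<2^n (suc m) = begin
      suc (suc m)    ≤⟨ s≤s (m≤n+m (suc m) m) ⟩
      suc m + suc m  ≤⟨ +-mono-≤ (n<2^n m) (n<2^n m) ⟩
      2 ^ m + 2 ^ m  ≡⟨ cong (2 ^ m +_) (sym (+-identityʳ (2 ^ m))) ⟩
      2 * 2 ^ m      ∎
      where open ≤-Reasoning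

  -- Each factor `M` is at most 2^M, so the left side is at most 2^(4M); this is where `M` has to be
  -- a quarter of the logarithm.
  4^M*M²≤ : ∀ M ℓ → M * 4 ≤ ℓ → 4 ^ M * (M * M) ≤ 2 ^ ℓ
  4^M*M²≤ M ℓ 4M≤ℓ = begin
    4 ^ M * (M * M)          ≤⟨ *-monoʳ-≤ (4 ^ M) (*-mono-≤ (n≤2^n M) (n≤2^n M)) ⟩
    4 ^ M * (2 ^ M * 2 ^ M)  ≡⟨ cong (4 ^ M *_) (sym (^-distribʳ-* M 2 2)) ⟩
    4 ^ M * 4 ^ M            ≡⟨ sym (^-distribʳ-* M 4 4) ⟩
    (2 ^ 4) ^ M              ≡⟨ ^-*-assoc 2 4 M ⟩
    2 ^ (4 * M)              ≤⟨ ^-monoʳ-≤ 2 (≤-trans (≤-reflexive (*-comm 4 M)) 4M≤ℓ) ⟩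
    2 ^ ℓ                    ∎
    where open ≤-Reasoning

  -- Once the quotient is positive, rounding down loses at most a factor 2.
  ℓ≤8*[ℓ/4] : ∀ ℓ → 4 ≤ ℓ → ℓ ≤ 8 * (ℓ / 4)
  ℓ≤8*[ℓ/4] ℓ 4≤ℓ = begin
    ℓ                      ≡⟨ m≡m%n+[m/n]*n ℓ 4 ⟩
    ℓ % 4 + ℓ / 4 * 4      ≤⟨ +-monoˡ-≤ (ℓ / 4 * 4) (<⇒≤ (m%n<n ℓ 4)) ⟩
    4 + ℓ / 4 * 4          ≤⟨ +-monoˡ-≤ (ℓ / 4 * 4) (*-monoˡ-≤ 4 (m≥n⇒m/n>0 4≤ℓ)) ⟩
    ℓ / 4 * 4 + ℓ / 4 * 4  ≡⟨ lem (ℓ / 4) ⟩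
    8 * (ℓ / 4)            ∎
    where
    open ≤-Reasoning
    lem : ∀ a → a * 4 + a * 4 ≡ 8 * a
    lem = solve-∀

  colorable-large : ∀ k → 16 ≤ k → ∀ (E : List (Subset n)) →
    All (λ e → 2 ≤ ∣ e ∣) E → All (λ e → k ≤ ∣ e ∣) E →
    q E ℚ.≤ (ℤ.+ 1 ℚ./ 32) ℚ.* (ℤ.+ ⌊log₂ k ⌋ ℚ./ 1) → TwoColorable E
  colorable-large {n} k 16≤k E sizes large q≤ =
    Averaging.colorable (n !) {{n !≢0}} (λ e → share (n ! + n !) ∣ e ∣) E k M {{k≢0}} {{M≢0}}
      (All.map (λ {e} 2≤ → share-* n ∣ e ∣ 2≤ (∣p∣≤n e)) sizes) large
      mass≤ (≤-trans (4^M*M²≤ M ℓ (m/n*n≤m ℓ 4)) (2^⌊log₂⌋≤ ℓ k refl {{k≢0}}))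
    where
    open ≤-Reasoning
    ℓ = ⌊log₂ k ⌋
    M = ℓ / 4
    k≢0 : NonZero k
    k≢0 = >-nonZero (≤-trans (s≤s z≤n) 16≤k)
    4≤ℓ : 4 ≤ ℓ
    4≤ℓ = ⌊log₂⌋-mono-≤ 16≤k
    M≢0 : NonZero M
    M≢0 = >-nonZero (m≥n⇒m/n>0 4≤ℓ)
    mass≤ : 8 * mass E ≤ M * 2 ^ n
    mass≤ = *-cancelˡ-≤ 8 (begin
      8 * (8 * mass E)    ≡⟨ sym (*-assoc 8 8 (mass E)) ⟩
      64 * mass E         ≤⟨ q≤⇒mass≤ E ℓ sizes q≤ ⟩
      ℓ * 2 ^ n           ≤⟨ *-monoˡ-≤ (2 ^ n) (ℓ≤8*[ℓ/4] ℓ 4≤ℓ) ⟩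
      8 * M * 2 ^ n       ≡⟨ *-assoc 8 M (2 ^ n) ⟩
      8 * (M * 2 ^ n)     ∎)

open import Data.Nat using (ℕ; _≤_)
open import Data.Nat.Logarithm using (⌊log₂_⌋)
open import Data.Integer using (+_)
open import Data.Rational using (ℚ; _*_; _/_; 0ℚ) renaming (_≤_ to _≤ℚ_; _<_ to _<ℚ_)
open import Data.Rational.Properties using (positive⁻¹)
open import Data.Fin.Subset using (Subset; ∣_∣)
open import Data.List using (List)
open import Data.List.Relation.Unary.All using (All)
open import Data.List.Relation.Unary.Unique.Propositional using (Unique)
open import Data.Product using (∃; _×_; _,_)

theorem1 : ∃ λ (δ : ℚ) → (0ℚ <ℚ δ) × (∃ λ (k₀ : ℕ) → ∀ (k : ℕ) → k₀ ≤ k →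
    ∀ (n : ℕ) (E : List (Subset n)) → Unique E →
    All (λ e → 2 ≤ ∣ e ∣) E → All (λ e → k ≤ ∣ e ∣) E →
    q E ≤ℚ δ * (+ ⌊log₂ k ⌋ / 1) → TwoColorable E)
-- With ℓ the rounded logarithm and M = ⌊ℓ/4⌋, ℓ/32 is at most M/4, the bound on q(H) required for
-- averaging; k ≥ 16 makes `M` positive.
theorem1 = + 1 / 32 , positive⁻¹ (+ 1 / 32) , 16 ,
  λ k 16≤k n E _ → Recoloring.colorable-large k 16≤k E
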